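{- Let $k,r\ge 1$ be integers. Then, as an identity of rational functions in $x$, $$F_{k,r}(x) = (-1)^{kr}\, x^{ -r(r-1+2k)/2}\, F_{k,r}\!\left(\frac 1x\right).$$
   Context: For integers $k,r\ge 1$ and $n\ge 0$, let $\alpha_{k,r}(n)$ be the number of $k\times r$ matrices $(m_{i,j})$ of non-negative integers such that $m_{i,j}\ge m_{i+1,j}$ for $1\le i<k$, $m_{i,j}\ge m_{i,j+1}$ for $1\le j<r$ (all rows and columns weakly decreasing), and $m_{1,1}+\dots+m_{1,r}=n$. Let $F_{k,r}(x)=\sum_{n=0}^\infty \alpha_{k,r}(n)x^n$ be the generating function. This power series is the expansion at $0$ of a rational function, also denoted $F_{k,r}$, and $F_{k,r}(1/x)$ means substitution of $1/x$ into this rational function. -}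

module Defs where

open import Data.Integer.Base as ℤ using (ℤ; +_; 0ℤ; 1ℤ)
import Data.Integer.Properties as ℤ
open import Data.List.Base using (List; []; _∷_; length; map; filter; upTo; applyUpTo; foldr; cartesianProductWith)
open import Data.List.Membership.Propositional using (_∈_)
open import Data.List.Membership.Propositional.Properties
  using (∈-cartesianProductWith⁺; ∈-filter⁺; ∈-filter⁻; ∈-upTo⁺)
import Data.List.Relation.Unary.AllPairs as AllPairs
import Data.List.Relation.Unary.All as ListAll
open import Data.List.Relation.Unary.Any using (here)
open import Data.List.Relation.Unary.Unique.Propositional using (Unique)
open import Data.List.Relation.Unary.Unique.Propositional.Properties
  using (cartesianProductWith⁺; filter⁺; upTo⁺)
open import Data.Nat.Base as ℕ using (ℕ; zero; suc; _∸_; _≤_; _<_; _≥_; s≤s)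
import Data.Nat.Properties as ℕ
open import Data.Product.Base using (∃-syntax; _×_; _,_; proj₂)
open import Data.Vec.Base as Vec using (Vec; []; _∷_)
open import Data.Vec.Properties using (∷-injective)
open import Data.Vec.Relation.Binary.Pointwise.Inductive as Pointwise using (Pointwise; []; _∷_)
open import Data.Vec.Relation.Unary.All as All using (All; []; _∷_)
open import Data.Vec.Relation.Unary.Linked as Linked using (Linked; []; [-]; _∷_)
open import Relation.Binary.PropositionalEquality
  using (_≡_; _≢_; _≗_; refl; sym; trans; cong; cong₂)
open import Relation.Nullary using (Dec; yes; no; contradiction)
open import Relation.Nullary.Decidable using (_×-dec_)

------------------------------------------------------------------------
-- Matrices with weakly decreasing rows and columns

Matrix : ℕ → ℕ → Set
Matrix k r = Vec (Vec ℕ r) k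

firstRowSum : ∀ {k r} → Matrix k r → ℕ
firstRowSum []      = 0
firstRowSum (v ∷ _) = Vec.sum v

RowsDecreasing : ∀ {k r} → Matrix k r → Set
RowsDecreasing = All (Linked _≥_)

ColumnsDecreasing : ∀ {k r} → Matrix k r → Set
ColumnsDecreasing = Linked (Pointwise _≥_)

Admissible : ∀ {k r} → ℕ → Matrix k r → Set
Admissible n M = RowsDecreasing M × ColumnsDecreasing M × firstRowSum M ≡ n

admissible? : ∀ {k r} n (M : Matrix k r) → Dec (Admissible n M)
admissible? n M =
  All.all? (Linked.linked? ℕ._≥?_) M ×-dec
  Linked.linked? (Pointwise.decidable ℕ._≥?_) M ×-dec
  (firstRowSum M ℕ.≟ n)

vectors : ∀ {A : Set} → List A → (n : ℕ) → List (Vec A n)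
vectors xs zero    = [] ∷ []
vectors xs (suc n) = cartesianProductWith _∷_ xs (vectors xs n)

-- Entries of an admissible matrix are at most n, so the search is finite;
-- ∈-admissibles⁺, ∈-admissibles⁻ and admissibles-unique show that the list
-- contains every admissible matrix exactly once and nothing else.
admissibles : ∀ k r → ℕ → List (Matrix k r)
admissibles k r n = filter (admissible? n) (vectors (vectors (upTo (suc n)) r) k)

α : ℕ → ℕ → ℕ → ℕ
α k r n = length (admissibles k r n)

∈-vectors⁺ : ∀ {A : Set} {xs : List A} {n} {v : Vec A n} → All (_∈ xs) v → v ∈ vectors xs n
∈-vectors⁺ []       = here refl
∈-vectors⁺ (p ∷ ps) = ∈-cartesianProductWith⁺ _∷_ p (∈-vectors⁺ ps)

vectors-unique : ∀ {A : Set} {xs : List A} → Unique xs → ∀ n → Unique (vectors xs n)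
vectors-unique u zero    = ListAll.[] AllPairs.∷ AllPairs.[]
vectors-unique u (suc n) = cartesianProductWith⁺ _∷_ ∷-injective u (vectors-unique u n)

private
  sum-bound : ∀ {r} (v : Vec ℕ r) → All (_≤ Vec.sum v) v
  sum-bound []      = []
  sum-bound (x ∷ v) =
    ℕ.m≤m+n x _ ∷ All.map (λ p → ℕ.≤-trans p (ℕ.m≤n+m _ x)) (sum-bound v)

  ≥-bound : ∀ {r n} {v w : Vec ℕ r} → Pointwise _≥_ v w → All (_≤ n) v → All (_≤ n) w
  ≥-bound []       []       = []
  ≥-bound (q ∷ qs) (p ∷ ps) = ℕ.≤-trans q p ∷ ≥-bound qs ps

  bounded : ∀ {k r n} {v : Vec ℕ r} {M : Matrix k r} →
            ColumnsDecreasing (v ∷ M) → All (_≤ n) v → All (All (_≤ n)) (v ∷ M)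
  bounded [-]                   b = b ∷ []
  bounded {M = _ ∷ _} (q ∷ qs)  b = b ∷ bounded qs (≥-bound q b)

  admissible-bounded : ∀ {k r n} (M : Matrix k r) → Admissible n M → All (All (_≤ n)) M
  admissible-bounded []      _                = []
  admissible-bounded (v ∷ M) (_ , c , refl) = bounded c (sum-bound v)

∈-admissibles⁺ : ∀ {k r n} {M : Matrix k r} → Admissible n M → M ∈ admissibles k r n
∈-admissibles⁺ {n = n} {M} a =
  ∈-filter⁺ (admissible? n)
    (∈-vectors⁺ (All.map (λ b → ∈-vectors⁺ (All.map (λ p → ∈-upTo⁺ (s≤s p)) b))
                         (admissible-bounded M a)))
    a

∈-admissibles⁻ : ∀ {k r n} {M : Matrix k r} → M ∈ admissibles k r n → Admissible n M
∈-admissibles⁻ {k} {r} {n} M∈ =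
  proj₂ (∈-filter⁻ (admissible? n) {xs = vectors (vectors (upTo (suc n)) r) k} M∈)

admissibles-unique : ∀ k r n → Unique (admissibles k r n)
admissibles-unique k r n =
  filter⁺ (admissible? n) (vectors-unique (vectors-unique (upTo⁺ (suc n)) r) k)

------------------------------------------------------------------------
-- Formal power series over ℤ

Series : Set
Series = ℕ → ℤ

infixl 7 _⊛_

_⊛_ : Series → Series → Series
(f ⊛ g) n = foldr ℤ._+_ 0ℤ (applyUpTo (λ i → f i ℤ.* g (n ∸ i)) (suc n))

------------------------------------------------------------------------
-- Polynomials over ℤ

-- Coefficients in increasing degree. Trailing zeros are allowed, so equality
-- of polynomials is _≈ₚ_ and not _≡_.
Poly : Set
Poly = List ℤ

coeff : Poly → Series
coeff []      _       = 0ℤ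
coeff (a ∷ p) zero    = a
coeff (a ∷ p) (suc n) = coeff p n

infix 4 _≈ₚ_

_≈ₚ_ : Poly → Poly → Set
p ≈ₚ q = coeff p ≗ coeff q

Nonzero : Poly → Set
Nonzero p = ∃[ n ] coeff p n ≢ 0ℤ

infixl 6 _+ₚ_
infixl 7 _*ₚ_

_+ₚ_ : Poly → Poly → Poly
[]      +ₚ q       = q
(a ∷ p) +ₚ []      = a ∷ p
(a ∷ p) +ₚ (b ∷ q) = (a ℤ.+ b) ∷ (p +ₚ q)

_*ₚ_ : Poly → Poly → Poly
[]      *ₚ q = []
(a ∷ p) *ₚ q = map (a ℤ.*_) q +ₚ (0ℤ ∷ (p *ₚ q))

coeff-+ₚ : ∀ p q n → coeff (p +ₚ q) n ≡ coeff p n ℤ.+ coeff q n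
coeff-+ₚ []      q       n       = sym (ℤ.+-identityˡ _)
coeff-+ₚ (a ∷ p) []      n       = sym (ℤ.+-identityʳ _)
coeff-+ₚ (a ∷ p) (b ∷ q) zero    = refl
coeff-+ₚ (a ∷ p) (b ∷ q) (suc n) = coeff-+ₚ p q n

coeff-scale : ∀ a p n → coeff (map (a ℤ.*_) p) n ≡ a ℤ.* coeff p n
coeff-scale a []      n       = sym (ℤ.*-zeroʳ a)
coeff-scale a (b ∷ p) zero    = refl
coeff-scale a (b ∷ p) (suc n) = coeff-scale a p n

coeff-∷-*ₚ : ∀ a p q n →
             coeff ((a ∷ p) *ₚ q) n ≡ a ℤ.* coeff q n ℤ.+ coeff (0ℤ ∷ (p *ₚ q)) n
coeff-∷-*ₚ a p q n = trans (coeff-+ₚ (map (a ℤ.*_) q) _ n) (cong (ℤ._+ _) (coeff-scale a q n))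

*ₚ-shift : ∀ p q → p *ₚ (0ℤ ∷ q) ≈ₚ 0ℤ ∷ (p *ₚ q)
*ₚ-shift []      q zero    = refl
*ₚ-shift []      q (suc n) = refl
*ₚ-shift (a ∷ p) q zero    =
  trans (coeff-∷-*ₚ a p (0ℤ ∷ q) 0) (trans (ℤ.+-identityʳ _) (ℤ.*-zeroʳ a))
*ₚ-shift (a ∷ p) q (suc n) =
  trans (coeff-∷-*ₚ a p (0ℤ ∷ q) (suc n))
    (trans (cong (λ z → a ℤ.* coeff q n ℤ.+ z) (*ₚ-shift p q n)) (sym (coeff-∷-*ₚ a p q n)))

private
  tail-nonzero : ∀ {a p} → a ≡ 0ℤ → Nonzero (a ∷ p) → Nonzero p
  tail-nonzero a≡0 (zero  , h) = contradiction a≡0 h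
  tail-nonzero a≡0 (suc n , h) = n , h

  head-*ₚ-nonzero : ∀ a p → a ≢ 0ℤ → ∀ q → Nonzero q → Nonzero ((a ∷ p) *ₚ q)
  head-*ₚ-nonzero a p a≢0 []      (_ , h) = contradiction refl h
  head-*ₚ-nonzero a p a≢0 (b ∷ q) hq with b ℤ.≟ 0ℤ
  ... | no b≢0 = 0 , λ e → b≢0
    (ℤ.*-cancelˡ-≡ a b 0ℤ {{ℤ.≢-nonZero a≢0}}
      (trans (trans (sym (ℤ.+-identityʳ _)) e) (sym (ℤ.*-zeroʳ a))))
  ... | yes refl with i , h ← head-*ₚ-nonzero a p a≢0 q (tail-nonzero refl hq) =
    suc i , λ e → h (trans (sym (*ₚ-shift (a ∷ p) q (suc i))) e)

*ₚ-nonzero : ∀ p q → Nonzero p → Nonzero q → Nonzero (p *ₚ q)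
*ₚ-nonzero []      q (_ , h) hq = contradiction refl h
*ₚ-nonzero (a ∷ p) q hp      hq with a ℤ.≟ 0ℤ
... | no a≢0 = head-*ₚ-nonzero a p a≢0 q hq
... | yes refl with i , h ← *ₚ-nonzero p q (tail-nonzero refl hp) hq =
  suc i , λ e → h (trans (sym (ℤ.+-identityˡ _)) (trans (sym (coeff-∷-*ₚ 0ℤ p q (suc i))) e))

------------------------------------------------------------------------
-- Rational functions: the fraction field of ℤ[x], that is ℚ(x)

record RatFun : Set where
  constructor frac
  field
    num         : Poly
    den         : Poly
    den-nonzero : Nonzero den

open RatFun public

infix  4 _≃_
infixl 6 _+ᵣ_
infixl 7 _·_
infixr 8 _^ᵣ_

_≃_ : RatFun → RatFun → Set
R ≃ S = num R *ₚ den S ≈ₚ num S *ₚ den R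

const : ℤ → RatFun
const a = frac (a ∷ []) (1ℤ ∷ []) (0 , λ ())

_+ᵣ_ : RatFun → RatFun → RatFun
R +ᵣ S = frac (num R *ₚ den S +ₚ num S *ₚ den R) (den R *ₚ den S)
              (*ₚ-nonzero (den R) (den S) (den-nonzero R) (den-nonzero S))

_·_ : RatFun → RatFun → RatFun
R · S = frac (num R *ₚ num S) (den R *ₚ den S)
             (*ₚ-nonzero (den R) (den S) (den-nonzero R) (den-nonzero S))

divide : (R S : RatFun) → Nonzero (num S) → RatFun
divide R S S≢0 = frac (num R *ₚ den S) (den R *ₚ num S)
                      (*ₚ-nonzero (den R) (num S) (den-nonzero R) S≢0)

_^ᵣ_ : RatFun → ℕ → RatFun
R ^ᵣ zero  = const 1ℤ
R ^ᵣ suc n = R · R ^ᵣ n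

x⁻¹ : RatFun
x⁻¹ = frac (1ℤ ∷ []) (0ℤ ∷ 1ℤ ∷ []) (1 , λ ())

-- The value p(g) of a polynomial p at a rational function g, by Horner's rule.
_at_ : Poly → RatFun → RatFun
[]      at g = const 0ℤ
(a ∷ p) at g = const a +ᵣ g · (p at g)

private
  one-*ₚ : ∀ a q → (a ∷ []) *ₚ q ≈ₚ map (a ℤ.*_) q
  one-*ₚ a q n = trans (coeff-+ₚ (map (a ℤ.*_) q) _ n) (trans (cong (λ z → coeff (map (a ℤ.*_) q) n ℤ.+ z) (zeros n)) (ℤ.+-identityʳ _))
    where
    zeros : ∀ n → coeff (0ℤ ∷ []) n ≡ 0ℤ
    zeros zero    = refl
    zeros (suc n) = refl

  *ₚ-identityˡ : ∀ q → (1ℤ ∷ []) *ₚ q ≈ₚ q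
  *ₚ-identityˡ q n = trans (one-*ₚ 1ℤ q n) (trans (coeff-scale 1ℤ q n) (ℤ.*-identityˡ _))

  *ₚ-identityʳ : ∀ p → p *ₚ (1ℤ ∷ []) ≈ₚ p
  *ₚ-identityʳ []      n       = refl
  *ₚ-identityʳ (a ∷ p) zero    = trans (ℤ.+-identityʳ _) (ℤ.*-identityʳ a)
  *ₚ-identityʳ (a ∷ p) (suc n) = trans (coeff-∷-*ₚ a p (1ℤ ∷ []) (suc n))
    (trans (cong₂ ℤ._+_ (ℤ.*-zeroʳ a) (*ₚ-identityʳ p n)) (ℤ.+-identityˡ _))

  x-*ₚ : ∀ q n → coeff ((0ℤ ∷ 1ℤ ∷ []) *ₚ q) (suc n) ≡ coeff q n
  x-*ₚ q n = trans (coeff-∷-*ₚ 0ℤ (1ℤ ∷ []) q (suc n)) (trans (ℤ.+-identityˡ _) (*ₚ-identityˡ q n))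

  den-top : ∀ p → coeff (den (p at x⁻¹)) (length p) ≡ 1ℤ
  den-top []      = refl
  den-top (a ∷ p) = trans (*ₚ-identityˡ (den x⁻¹ *ₚ d) (suc (length p))) (trans (x-*ₚ d (length p)) (den-top p))
    where d = den (p at x⁻¹)

  num-step : ∀ a p n → coeff (num ((a ∷ p) at x⁻¹)) n ≡
             a ℤ.* coeff (den x⁻¹ *ₚ den (p at x⁻¹)) n ℤ.+ coeff (num (p at x⁻¹)) n
  num-step a p n = trans (coeff-+ₚ ((a ∷ []) *ₚ D) _ n)
    (cong₂ ℤ._+_ (trans (one-*ₚ a D n) (coeff-scale a D n))
                 (trans (*ₚ-identityʳ ((1ℤ ∷ []) *ₚ N) n) (*ₚ-identityˡ N n)))
    where
    D = den x⁻¹ *ₚ den (p at x⁻¹)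
    N = num (p at x⁻¹)

  den-high : ∀ p n → length p < n → coeff (den (p at x⁻¹)) n ≡ 0ℤ
  den-high []      (suc n) _       = refl
  den-high (a ∷ p) (suc n) (s≤s h) =
    trans (*ₚ-identityˡ (den x⁻¹ *ₚ d) (suc n)) (trans (x-*ₚ d n) (den-high p n h))
    where d = den (p at x⁻¹)

  num-high : ∀ p n → length p < n → coeff (num (p at x⁻¹)) n ≡ 0ℤ
  num-high []      (suc n) _       = refl
  num-high (a ∷ p) (suc n) (s≤s h) = trans (num-step a p (suc n))
    (cong₂ ℤ._+_ (trans (cong (a ℤ.*_) (trans (x-*ₚ (den (p at x⁻¹)) n) (den-high p n h))) (ℤ.*-zeroʳ a))
                 (num-high p (suc n) (ℕ.m<n⇒m<1+n h)))

at-x⁻¹-nonzero : ∀ p → Nonzero p → Nonzero (num (p at x⁻¹))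
at-x⁻¹-nonzero []      (_ , h) = contradiction refl h
at-x⁻¹-nonzero (a ∷ p) hp with a ℤ.≟ 0ℤ
... | no a≢0 = suc (length p) , λ e → a≢0 (trans (sym value) e)
  where
  value : coeff (num ((a ∷ p) at x⁻¹)) (suc (length p)) ≡ a
  value = trans (num-step a p (suc (length p)))
    (trans (cong₂ ℤ._+_ (trans (cong (a ℤ.*_) (trans (x-*ₚ (den (p at x⁻¹)) (length p)) (den-top p)))
                               (ℤ.*-identityʳ a))
                        (num-high p (suc (length p)) (ℕ.n<1+n _)))
           (ℤ.+-identityʳ a))
... | yes refl with i , h ← at-x⁻¹-nonzero p (tail-nonzero refl hp) =
  i , λ e → h (trans (sym (ℤ.+-identityˡ _)) (trans (sym (num-step 0ℤ p i)) e))

infix 9 _⟨1/x⟩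

-- R(1/x), as the quotient of the values of numerator and denominator at 1/x.
_⟨1/x⟩ : RatFun → RatFun
R ⟨1/x⟩ = divide (num R at x⁻¹) (den R at x⁻¹) (at-x⁻¹-nonzero (den R) (den-nonzero R))

infix 4 _ExpandsTo_

-- f is the expansion at 0 of R. Since ℤ[[x]] is an integral domain, this
-- determines f from R, and R from f up to _≃_. If it holds, then R in lowest
-- terms has no pole at 0, so den R itself need not be nonzero at 0.
_ExpandsTo_ : RatFun → Series → Set
R ExpandsTo f = coeff (den R) ⊛ f ≗ coeff (num R)

{-# OPTIONS --safe #-}
-- Counting the chains of rows below a fixed first row by signed sums over intervals (so that the sum over
-- a ≤ m < b is minus the sum over b ≤ m < a) makes sense for arbitrary integer vectors, and extends
-- α_{k,r} to a quasi-polynomial A on ℤ. Substituting m ↦ c - m in every sum, with c decreasing by one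
-- from each entry of a row to the next larger one and from each row to the one above, only reverses
-- the kr - 1 summations. The interval boundaries match up to terms in which some inner factor vanishes,
-- whence A(-s-n) = (-1)^{kr-1} A(n) and A = 0 on -s < n < 0, where s = r(r-1+2k)/2. As A is annihilated by
-- D = (1 - x^M)^d on all of ℤ, the product N of D and F is a polynomial, and the symmetries of A and D
-- translate into N(1/x) = ± x^{s - deg D} N(x).
module Submission where

open import Defs
open import Data.Integer.Base as ℤ using (+_; -1ℤ)

open import Algebra.Bundles using (CommutativeMonoid)
open import Data.Empty using (⊥; ⊥-elim)
open import Data.Integer.Base using (ℤ; -[1+_]; 0ℤ; 1ℤ; -_; _-_; _^_; _/ℕ_; +≤+)
open import Data.Integer.DivMod using ([n/ℕd]*d≤n; n<s[n/ℕd]*d)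
import Data.Integer.Properties as ℤ
import Algebra.Properties.AbelianGroup ℤ.+-0-abelianGroup as ℤ+
open import Data.Integer.Tactic.RingSolver using (solve-∀)
open import Data.List.Base using (List; []; _∷_; applyUpTo; concatMap; foldr; length; map; _++_)
open import Data.List.Membership.Propositional using (_∈_; find; lose)
open import Data.List.Membership.Propositional.Properties
  using (∈-concatMap⁺; ∈-concatMap⁻; ∈-map⁺; ∈-map⁻; ∈-applyUpTo⁺; ∈-applyUpTo⁻)
open import Data.List.Membership.Propositional.Properties.WithK using (unique∧set⇒bag)
import Data.List.Properties as List
open import Data.List.Relation.Binary.BagAndSetEquality using (∼bag⇒↭)
open import Data.List.Relation.Binary.Permutation.Propositional.Properties using (↭-length)
import Data.List.Relation.Unary.All as ListAll
import Data.List.Relation.Unary.AllPairs as AllPairs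
open import Data.List.Relation.Unary.Any using (here; there)
open import Data.List.Relation.Unary.Unique.Propositional using (Unique)
import Data.List.Relation.Unary.Unique.Propositional.Properties as Unique
open import Data.Nat.Base as ℕ using (ℕ; zero; suc; z≤n; s≤s)
open import Data.Nat.DivMod using (m/n*n≤m; m*n/n≡m; /-monoˡ-≤)
import Data.Nat.Properties as ℕ
open import Data.Nat.Tactic.RingSolver using () renaming (solve-∀ to ℕsolve-∀)
open import Data.Product.Base using (∃-syntax; _×_; _,_; proj₁; proj₂)
open import Data.Unit.Base using (⊤; tt)
open import Data.Vec.Base as Vec using (Vec; []; _∷_; _∷ʳ_; head; tail; reverse; zipWith)
import Data.Vec.Properties as Vec
open import Data.Vec.Relation.Binary.Pointwise.Inductive as Pointwise using (Pointwise; []; _∷_)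
open import Data.Vec.Relation.Unary.All using (All; []; _∷_)
open import Data.Vec.Relation.Unary.Linked using (Linked; []; [-]; _∷_)
open import Function.Base using (_∘_; case_of_)
open import Function.Bundles using (mk⇔)
open import Level using (Level)
open import Relation.Binary.PropositionalEquality
  using (_≡_; _≗_; refl; sym; trans; cong; cong₂; subst; module ≡-Reasoning)
open import Relation.Nullary using (yes; no)
open ≡-Reasoning

-- Signed sums over intervals of ℤ

-- Swapping the bounds of a signed sum turns l ≤ m ≤ x into x < m < l, so reversal exchanges weak
-- and strict inequalities; the decrease of c by one per step absorbs the difference. Two boundaries
-- do not match by themselves. The lower bound 0 of a row with K rows below it is reflected to -K;
-- the chains below have `f K` = 0 when the first entry is negative but at least -K. In the first
-- row the prescribed sum forces the largest entry and bounds the others by a quotient, whose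
-- rounding does not commute with reflection; the values of m gained or lost carry inner sums that
-- vanish. This quotient is also the only source of a period: everything below the first row is
-- polynomial. The symmetry of A concerns a two-sided sequence, while F sees only n ≥ 0. The two
-- halves are tied together because D annihilates the whole sequence, so that the product of D with
-- one half is minus its product with the other.

module SignedSums where
  open import Data.Integer.Base using (_+_; _*_; _≤_)

  ℤ-induction : (P : ℤ → Set) → P 0ℤ → (∀ b → P b → P (b + 1ℤ)) → (∀ b → P (b + 1ℤ) → P b) → ∀ b → P b
  ℤ-induction P z up down (+ zero)  = z
  ℤ-induction P z up down (+ suc n) =
    subst (P ∘ +_) (ℕ.+-comm n 1) (up (+ n) (ℤ-induction P z up down (+ n)))
  ℤ-induction P z up down -[1+ zero ]  = down -[1+ 0 ] z
  ℤ-induction P z up down -[1+ suc n ] = down -[1+ suc n ] (ℤ-induction P z up down -[1+ n ])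

  -- Linear arithmetic: an inequality holds if its two sides differ by as much as those of a sum of
  -- known inequalities, which is left to the ring solver.
  ≤-from : ∀ {i j} x y → i ≤ j → y - x ≡ j - i → x ≤ y
  ≤-from x y p e = ℤ.0≤i-j⇒j≤i (subst (0ℤ ≤_) (sym e) (ℤ.i≤j⇒0≤j-i p))

  ≤-absurd : ∀ {i j} n → i ≤ j → j - i ≡ -[1+ n ] → ⊥
  ≤-absurd n p e with () ← subst (0ℤ ≤_) e (ℤ.i≤j⇒0≤j-i p)

  -- The discrete primitive of `h` that vanishes at 0. With sums over intervals as its differences,
  -- additivity holds for all bounds without comparing them.
  antidiff : (ℤ → ℤ) → ℤ → ℤ
  antidiff h (+ zero)      = 0ℤ
  antidiff h (+ suc n)     = antidiff h (+ n) + h (+ n)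
  antidiff h -[1+ zero ]   = - h -[1+ 0 ]
  antidiff h -[1+ suc n ]  = antidiff h -[1+ n ] - h -[1+ suc n ]

  antidiff-suc : ∀ h b → antidiff h (b + 1ℤ) ≡ antidiff h b + h b
  antidiff-suc h (+ n) rewrite ℕ.+-comm n 1 = refl
  antidiff-suc h -[1+ zero ]  = sym (ℤ.+-inverseˡ (h -[1+ 0 ]))
  antidiff-suc h -[1+ suc n ] = cancel (antidiff h -[1+ n ]) (h -[1+ suc n ])
    where
    cancel : ∀ a b → a ≡ a - b + b
    cancel = solve-∀

  -- A sequence on ℤ is determined by its value at 0 and its first differences. Linearity,
  -- translation and reflection of sums are thereby reduced to checking a single step.
  antidiff-unique : ∀ h (G : ℤ → ℤ) → G 0ℤ ≡ 0ℤ → (∀ b → G (b + 1ℤ) ≡ G b + h b) → ∀ b → antidiff h b ≡ G b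
  antidiff-unique h G z step = ℤ-induction _ (sym z)
    (λ b ih → trans (antidiff-suc h b) (trans (cong (_+ h b) ih) (sym (step b))))
    (λ b ih → ℤ+.∙-cancelʳ (h b) _ _ (trans (sym (antidiff-suc h b)) (trans ih (step b))))

  -- ∑ h a b is the sum of h m over a ≤ m < b, with ∑ h a b = - ∑ h b a for b < a.
  ∑ : (ℤ → ℤ) → ℤ → ℤ → ℤ
  ∑ h a b = antidiff h b - antidiff h a

  antidiff-cong : ∀ {h h′} → h ≗ h′ → antidiff h ≗ antidiff h′
  antidiff-cong {h} {h′} e = antidiff-unique h (antidiff h′) refl
    (λ b → trans (antidiff-suc h′ b) (cong (λ z → antidiff h′ b + z) (sym (e b))))

  ∑-cong : ∀ {h h′} → h ≗ h′ → ∀ a b → ∑ h a b ≡ ∑ h′ a b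
  ∑-cong e a b = cong₂ _-_ (antidiff-cong e b) (antidiff-cong e a)

  antidiff-* : ∀ c h b → antidiff (λ m → c * h m) b ≡ c * antidiff h b
  antidiff-* c h = antidiff-unique _ (λ b → c * antidiff h b) (ℤ.*-zeroʳ c)
    λ b → trans (cong (c *_) (antidiff-suc h b)) (ℤ.*-distribˡ-+ c (antidiff h b) (h b))

  antidiff-- : ∀ h h′ b → antidiff (λ m → h m - h′ m) b ≡ antidiff h b - antidiff h′ b
  antidiff-- h h′ = antidiff-unique _ (λ b → antidiff h b - antidiff h′ b) refl
    λ b → trans (cong₂ _-_ (antidiff-suc h b) (antidiff-suc h′ b))
                (swap (antidiff h b) (h b) (antidiff h′ b) (h′ b))
    where
    swap : ∀ a b c d → (a + b) - (c + d) ≡ (a - c) + (b - d)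
    swap = solve-∀

  antidiff-shift : ∀ h z b → antidiff (λ m → h (m + z)) b ≡ antidiff h (b + z) - antidiff h z
  antidiff-shift h z = antidiff-unique _ (λ b → antidiff h (b + z) - antidiff h z)
    (trans (cong (λ w → antidiff h w - antidiff h z) (ℤ.+-identityˡ z)) (ℤ.+-inverseʳ (antidiff h z)))
    λ b → begin
      antidiff h (b + 1ℤ + z) - antidiff h z          ≡⟨ cong (λ w → antidiff h w - antidiff h z) (swap b z) ⟩
      antidiff h (b + z + 1ℤ) - antidiff h z          ≡⟨ cong (_- antidiff h z) (antidiff-suc h (b + z)) ⟩
      antidiff h (b + z) + h (b + z) - antidiff h z   ≡⟨ swap′ (antidiff h (b + z)) (h (b + z)) (antidiff h z) ⟩
      antidiff h (b + z) - antidiff h z + h (b + z)   ∎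
    where
    swap : ∀ b z → b + 1ℤ + z ≡ b + z + 1ℤ
    swap = solve-∀
    swap′ : ∀ a b c → a + b - c ≡ a - c + b
    swap′ = solve-∀

  antidiff-reflect : ∀ h c b → antidiff (λ m → h (c - m)) b ≡ antidiff h (c + 1ℤ) - antidiff h (c + 1ℤ - b)
  antidiff-reflect h c = antidiff-unique _ (λ b → antidiff h (c + 1ℤ) - antidiff h (c + 1ℤ - b))
    (trans (cong (λ w → antidiff h (c + 1ℤ) - antidiff h w) (ℤ.+-identityʳ (c + 1ℤ))) (ℤ.+-inverseʳ (antidiff h (c + 1ℤ))))
    λ b → begin
      antidiff h (c + 1ℤ) - antidiff h (c + 1ℤ - (b + 1ℤ))
        ≡⟨ cong (λ w → antidiff h (c + 1ℤ) - antidiff h w) (e₁ c b) ⟩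
      antidiff h (c + 1ℤ) - antidiff h (c - b)
        ≡⟨ e₃ (antidiff h (c + 1ℤ)) (antidiff h (c - b)) (h (c - b)) ⟩
      antidiff h (c + 1ℤ) - (antidiff h (c - b) + h (c - b)) + h (c - b)
        ≡⟨ cong (λ w → antidiff h (c + 1ℤ) - w + h (c - b)) (antidiff-suc h (c - b)) ⟨
      antidiff h (c + 1ℤ) - antidiff h (c - b + 1ℤ) + h (c - b)
        ≡⟨ cong (λ w → antidiff h (c + 1ℤ) - antidiff h w + h (c - b)) (e₂ c b) ⟩
      antidiff h (c + 1ℤ) - antidiff h (c + 1ℤ - b) + h (c - b) ∎
    where
    e₁ : ∀ c b → c + 1ℤ - (b + 1ℤ) ≡ c - b
    e₁ = solve-∀
    e₂ : ∀ c b → c - b + 1ℤ ≡ c + 1ℤ - b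
    e₂ = solve-∀
    e₃ : ∀ x y z → x - y ≡ x - (y + z) + z
    e₃ = solve-∀

  ∑-suc : ∀ h a b → ∑ h a (b + 1ℤ) ≡ ∑ h a b + h b
  ∑-suc h a b = trans (cong (_- antidiff h a) (antidiff-suc h b)) (e (antidiff h b) (h b) (antidiff h a))
    where
    e : ∀ x y z → x + y - z ≡ x - z + y
    e = solve-∀

  ∑-- : ∀ h h′ a b → ∑ (λ m → h m - h′ m) a b ≡ ∑ h a b - ∑ h′ a b
  ∑-- h h′ a b = trans (cong₂ _-_ (antidiff-- h h′ b) (antidiff-- h h′ a))
    (e (antidiff h b) (antidiff h′ b) (antidiff h a) (antidiff h′ a))
    where
    e : ∀ a b c d → (a - b) - (c - d) ≡ (a - c) - (b - d)
    e = solve-∀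

  ∑-* : ∀ c h a b → ∑ (λ m → c * h m) a b ≡ c * ∑ h a b
  ∑-* c h a b = trans (cong₂ _-_ (antidiff-* c h b) (antidiff-* c h a)) (e c (antidiff h b) (antidiff h a))
    where
    e : ∀ c a b → c * a - c * b ≡ c * (a - b)
    e = solve-∀

  ∑-shift : ∀ h z a b → ∑ (λ m → h (m + z)) a b ≡ ∑ h (a + z) (b + z)
  ∑-shift h z a b = trans (cong₂ _-_ (antidiff-shift h z b) (antidiff-shift h z a))
    (e (antidiff h (b + z)) (antidiff h z) (antidiff h (a + z)))
    where
    e : ∀ x y w → (x - y) - (w - y) ≡ x - w
    e = solve-∀

  -- Intervals are half-open: a ≤ m < b becomes c + 1 - b ≤ c - m < c + 1 - a.
  ∑-reflect : ∀ h c a b → ∑ (λ m → h (c - m)) a b ≡ ∑ h (c + 1ℤ - b) (c + 1ℤ - a)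
  ∑-reflect h c a b = trans (cong₂ _-_ (antidiff-reflect h c b) (antidiff-reflect h c a))
    (e (antidiff h (c + 1ℤ)) (antidiff h (c + 1ℤ - b)) (antidiff h (c + 1ℤ - a)))
    where
    e : ∀ x y w → (x - y) - (x - w) ≡ w - y
    e = solve-∀

  ∑-flip : ∀ h a b → ∑ h a b ≡ - ∑ h b a
  ∑-flip h a b = e (antidiff h b) (antidiff h a)
    where
    e : ∀ x y → x - y ≡ - (y - x)
    e = solve-∀

  ∑-split : ∀ h a b c → ∑ h a c ≡ ∑ h a b + ∑ h b c
  ∑-split h a b c = e (antidiff h a) (antidiff h b) (antidiff h c)
    where
    e : ∀ x y z → z - x ≡ (y - x) + (z - y)
    e = solve-∀

  ∑-empty : ∀ h a → ∑ h a a ≡ 0ℤ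
  ∑-empty h a = ℤ.+-inverseʳ (antidiff h a)

  ∑-vanish-up : ∀ h a n → (∀ m → a ≤ m → m + 1ℤ ≤ a + + n → h m ≡ 0ℤ) → ∑ h a (a + + n) ≡ 0ℤ
  ∑-vanish-up h a zero    hyp = trans (cong (∑ h a) (ℤ.+-identityʳ a)) (∑-empty h a)
  ∑-vanish-up h a (suc n) hyp = begin
    ∑ h a (a + + suc n)           ≡⟨ cong (∑ h a) (next a n) ⟩
    ∑ h a (a + + n + 1ℤ)          ≡⟨ ∑-suc h a (a + + n) ⟩
    ∑ h a (a + + n) + h (a + + n) ≡⟨ cong₂ _+_
        (∑-vanish-up h a n λ m a≤m m<n → hyp m a≤m (ℤ.≤-trans m<n (ℤ.+-monoʳ-≤ a (+≤+ (ℕ.n≤1+n n)))))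
        (hyp (a + + n) (ℤ.i≤i+j a (+ n)) (ℤ.≤-reflexive (sym (next a n)))) ⟩
    0ℤ ∎
    where
    next : ∀ a (n : ℕ) → a + + suc n ≡ a + + n + 1ℤ
    next a n = trans (cong (λ k → a + + k) (ℕ.+-comm 1 n)) (sym (ℤ.+-assoc a (+ n) 1ℤ))

  -- The second hypothesis serves the reversed interval b ≤ m < a. At most one of the two intervals
  -- is nonempty, and callers need not decide which.
  ∑-vanish : ∀ h a b → (∀ m → a ≤ m → m + 1ℤ ≤ b → h m ≡ 0ℤ) →
                       (∀ m → b ≤ m → m + 1ℤ ≤ a → h m ≡ 0ℤ) → ∑ h a b ≡ 0ℤ
  ∑-vanish h a b up down = split (b - a) refl
    where
    e₁ : ∀ a b → a + (b - a) ≡ b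
    e₁ = solve-∀
    e₂ : ∀ a b → b - (b - a) ≡ a
    e₂ = solve-∀
    split : ∀ z → b - a ≡ z → ∑ h a b ≡ 0ℤ
    split (+ n) eq with refl ← trans (sym (e₁ a b)) (cong (λ w → a + w) eq) =
      ∑-vanish-up h a n up
    split -[1+ n ] eq with refl ← trans (sym (e₂ a b)) (cong (λ z → b - z) eq) =
      trans (∑-flip h (b + + suc n) b) (cong -_ (∑-vanish-up h b (suc n) down))

open SignedSums

-- Extending the counting function to ℤ, and its reflection

module Reflection where
  open import Data.Integer.Base using (_+_; _*_; _≤_)

  <⇒+1≤ : ∀ {i j} → i ℤ.< j → i + 1ℤ ≤ j
  <⇒+1≤ {i} i<j = subst (_≤ _) (ℤ.+-comm 1ℤ i) (ℤ.i<j⇒suc[i]≤j i<j)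

  ≤-/⇒*≤ : ∀ q n d .{{_ : ℕ.NonZero d}} → q ≤ n /ℕ d → q * + d ≤ n
  ≤-/⇒*≤ q n d q≤ = ℤ.≤-trans (ℤ.*-monoʳ-≤-nonNeg (+ d) q≤) ([n/ℕd]*d≤n n d)

  /<⇒<* : ∀ q n d .{{_ : ℕ.NonZero d}} → n /ℕ d + 1ℤ ≤ q → n + 1ℤ ≤ q * + d
  /<⇒<* q n d <q = ℤ.≤-trans (<⇒+1≤ (n<s[n/ℕd]*d n d))
    (ℤ.*-monoʳ-≤-nonNeg (+ d) (subst (_≤ q) (ℤ.+-comm (n /ℕ d) 1ℤ) <q))

  *≤⇒≤-/ : ∀ q n d .{{_ : ℕ.NonZero d}} → q * + d ≤ n → q ≤ n /ℕ d
  *≤⇒≤-/ q n d p with q ℤ.≤? n /ℕ d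
  ... | yes q≤ = q≤
  ... | no q≰  = ⊥-elim (≤-absurd 0 (ℤ.+-mono-≤ (/<⇒<* q n d (<⇒+1≤ (ℤ.≰⇒> q≰))) p) (e n (q * + d)))
    where
    e : ∀ n x → (x + n) - (n + 1ℤ + x) ≡ -1ℤ
    e = solve-∀

  <*⇒/< : ∀ q n d .{{_ : ℕ.NonZero d}} → n + 1ℤ ≤ q * + d → n /ℕ d + 1ℤ ≤ q
  <*⇒/< q n d p with q ℤ.≤? n /ℕ d
  ... | yes q≤ = ⊥-elim (≤-absurd 0 (ℤ.+-mono-≤ p (≤-/⇒*≤ q n d q≤)) (e n (q * + d)))
    where
    e : ∀ n x → (x + n) - (n + 1ℤ + x) ≡ -1ℤ
    e = solve-∀
  ... | no q≰  = <⇒+1≤ (ℤ.≰⇒> q≰)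

  sgn : ℕ → ℤ
  sgn n = -1ℤ ^ n

  -- Rows are stored in increasing order, so that the entry chosen last is the lower bound for the
  -- next one. T l (x₁ ∷ … ∷ xₜ) g sums g m₁ … mₜ over l ≤ m₁ ≤ … ≤ mₜ with mᵢ ≤ xᵢ.
  T : ∀ {t} → ℤ → Vec ℤ t → (Vec ℤ t → ℤ) → ℤ
  T l []       g = g []
  T l (x ∷ xs) g = ∑ (λ m → T m xs (λ v → g (m ∷ v))) l (x + 1ℤ)

  -- U j l n g sums g m₀ … mⱼ over l ≤ m₀ ≤ … ≤ mⱼ with m₀ + … + mⱼ = n. The bound on m₀ is
  -- (j + 1) m₀ ≤ n; the quotient _/ℕ_ is rounded down also for negative n.
  U : ∀ j → ℤ → ℤ → (Vec ℤ (suc j) → ℤ) → ℤ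
  U zero    l n g = g (n ∷ [])
  U (suc j) l n g = ∑ (λ p → U j p (n - p) (λ v → g (p ∷ v))) l (n /ℕ suc (suc j) + 1ℤ)

  T-cong : ∀ {t} l (xs : Vec ℤ t) {g g′} → g ≗ g′ → T l xs g ≡ T l xs g′
  T-cong l []       e = e []
  T-cong l (x ∷ xs) e = ∑-cong (λ m → T-cong m xs (λ v → e (m ∷ v))) l (x + 1ℤ)

  U-cong : ∀ j l n {g g′} → g ≗ g′ → U j l n g ≡ U j l n g′
  U-cong zero    l n e = e (n ∷ [])
  U-cong (suc j) l n e = ∑-cong (λ p → U-cong j p (n - p) (λ v → e (p ∷ v))) l (n /ℕ suc (suc j) + 1ℤ)

  T-* : ∀ {t} c l (xs : Vec ℤ t) g → T l xs (λ v → c * g v) ≡ c * T l xs g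
  T-* c l []       g = refl
  T-* c l (x ∷ xs) g = trans (∑-cong (λ m → T-* c m xs (λ v → g (m ∷ v))) l (x + 1ℤ)) (∑-* c _ l (x + 1ℤ))

  U-* : ∀ j c l n g → U j l n (λ v → c * g v) ≡ c * U j l n g
  U-* zero    c l n g = refl
  U-* (suc j) c l n g =
    trans (∑-cong (λ p → U-* j c p (n - p) (λ v → g (p ∷ v))) l q) (∑-* c (λ p → U j p (n - p) (λ v → g (p ∷ v))) l q)
    where q = n /ℕ suc (suc j) + 1ℤ

  T-zero : ∀ {t} l (xs : Vec ℤ t) {g} → (∀ v → g v ≡ 0ℤ) → T l xs g ≡ 0ℤ
  T-zero l xs {g} e = trans (T-cong l xs (λ v → e v)) (T-* 0ℤ l xs (λ _ → 0ℤ))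

  U-zero : ∀ j l n {g} → (∀ v → g v ≡ 0ℤ) → U j l n g ≡ 0ℤ
  U-zero j l n {g} e = trans (U-cong j l n (λ v → e v)) (U-* j 0ℤ l n (λ _ → 0ℤ))

  -- Reversed sums have m₂ < m₁ in place of m₁ ≤ m₂. As m₂ < m₁ amounts to c - m₁ ≤ (c - 1) - m₂,
  -- lowering `c` along the vector makes the inequalities weak again.
  reflect : ∀ {t} → ℤ → Vec ℤ t → Vec ℤ t
  reflect c []       = []
  reflect c (x ∷ xs) = (c - x) ∷ reflect (c - 1ℤ) xs

  -- When m goes to c - m, the half-open interval requires c + 1 for the lower bound and c - 1 for
  -- the upper one. These are the constants of the neighbouring entries, so the boundaries match
  -- exactly and each summation contributes a factor -1.
  T-reflect : ∀ {t} c l (xs : Vec ℤ t) g →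
              T (c + 1ℤ - l) (reflect (c - 1ℤ) xs) g ≡ sgn t * T l xs (λ v → g (reflect c v))
  T-reflect c l []       g = sym (ℤ.*-identityˡ _)
  T-reflect {suc t} c l (x ∷ xs) g = begin
    ∑ h (c + 1ℤ - l) (c - 1ℤ - x + 1ℤ)           ≡⟨ ∑-flip h (c + 1ℤ - l) (c - 1ℤ - x + 1ℤ) ⟩
    - ∑ h (c - 1ℤ - x + 1ℤ) (c + 1ℤ - l)         ≡⟨ cong (λ z → - ∑ h z (c + 1ℤ - l)) (e₁ c x) ⟩
    - ∑ h (c + 1ℤ - (x + 1ℤ)) (c + 1ℤ - l)       ≡⟨ cong -_ (∑-reflect h c l (x + 1ℤ)) ⟨
    - ∑ (λ m → h (c - m)) l (x + 1ℤ)             ≡⟨ cong -_ (∑-cong step l (x + 1ℤ)) ⟩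
    - ∑ (λ m → sgn t * k m) l (x + 1ℤ)           ≡⟨ cong -_ (∑-* (sgn t) k l (x + 1ℤ)) ⟩
    - (sgn t * ∑ k l (x + 1ℤ))                   ≡⟨ e₂ (sgn t) (∑ k l (x + 1ℤ)) ⟩
    sgn (suc t) * ∑ k l (x + 1ℤ)                 ∎
    where
    h k : ℤ → ℤ
    h m = T m (reflect (c - 1ℤ - 1ℤ) xs) (λ v → g (m ∷ v))
    k m = T m xs (λ v → g (reflect c (m ∷ v)))
    e₁ : ∀ c x → c - 1ℤ - x + 1ℤ ≡ c + 1ℤ - (x + 1ℤ)
    e₁ = solve-∀
    e₂ : ∀ a b → - (a * b) ≡ -1ℤ * a * b
    e₂ = solve-∀
    e₃ : ∀ c m → c - m ≡ c - 1ℤ + 1ℤ - m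
    e₃ = solve-∀
    step : ∀ m → h (c - m) ≡ sgn t * k m
    step m = trans (cong (λ z → T z (reflect (c - 1ℤ - 1ℤ) xs) (λ v → g ((c - m) ∷ v))) (e₃ c m))
                   (T-reflect (c - 1ℤ) m xs (λ v → g ((c - m) ∷ v)))

  -- τ j = 1 + 2 + … + (j + 1)
  τ : ℕ → ℤ
  τ zero    = 1ℤ
  τ (suc j) = τ j + + suc (suc j)

  1≤τ : ∀ j → 1ℤ ≤ τ j
  1≤τ zero    = ℤ.≤-refl
  1≤τ (suc j) = ℤ.≤-trans (1≤τ j) (ℤ.i≤i+j (τ j) (+ suc (suc j)))

  -- The interval of summation is reversed here, and each summand on it is of the same kind with one
  -- summation less; for j = 0 the hypotheses are contradictory.
  U-vanish : ∀ j l n g → n + 1ℤ ≤ l * + suc j → l * + suc j + 1ℤ ≤ n + τ j → U j l n g ≡ 0ℤ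
  U-vanish zero    l n g lo hi = ⊥-elim (≤-absurd 0 (ℤ.+-mono-≤ lo hi) (e l n))
    where
    e : ∀ l n → l * 1ℤ + (n + 1ℤ) - (n + 1ℤ + (l * 1ℤ + 1ℤ)) ≡ -1ℤ
    e = solve-∀
  U-vanish (suc j) l n g lo hi = ∑-vanish _ l _
    (λ m l≤m m≤q → ⊥-elim (≤-absurd 0
      (ℤ.+-mono-≤ (ℤ.+-mono-≤ lo (ℤ.*-monoʳ-≤-nonNeg J l≤m))
                  (≤-/⇒*≤ m n (suc (suc j)) (≤-from m (n /ℕ suc (suc j)) m≤q (e₀ m (n /ℕ suc (suc j))))))
      (e₁ n (l * J) (m * J))))
    (λ m q<m m<l → U-vanish j m (n - m) _
      (≤-from _ _ (/<⇒<* m n (suc (suc j)) q<m) (e₂ n m (+ suc j)))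
      (≤-from _ _ (ℤ.+-mono-≤ (ℤ.*-monoʳ-≤-nonNeg J m<l) hi) (e₃ n m l (+ suc j) (τ j))))
    where
    J = + suc (suc j)
    e₀ : ∀ m q → q - m ≡ q + 1ℤ - (m + 1ℤ)
    e₀ = solve-∀
    e₁ : ∀ n x y → x + y + n - (n + 1ℤ + x + y) ≡ -1ℤ
    e₁ = solve-∀
    e₂ : ∀ n m w → m * w - (n - m + 1ℤ) ≡ m * (1ℤ + w) - (n + 1ℤ)
    e₂ = solve-∀
    e₃ : ∀ n m l w t → n - m + t - (m * w + 1ℤ) ≡
         (l * (1ℤ + w) + (n + (t + (1ℤ + w)))) - ((m + 1ℤ) * (1ℤ + w) + (l * (1ℤ + w) + 1ℤ))
    e₃ = solve-∀

  -- The entries mᵢ become c - i - mᵢ, with sum (j + 1) c - j (j + 1) / 2 - n, which is the new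
  -- total on the left. The last entry is forced, so only `j` summations are reversed.
  U-reflect : ∀ j c l n g → U j (c + 1ℤ - l) ((c + 1ℤ) * + suc j - τ j - n) g ≡
                            sgn j * U j l n (λ v → g (reflect c v))
  U-reflect zero    c l n g = trans (cong (λ z → g (z ∷ [])) (e c n)) (sym (ℤ.*-identityˡ _))
    where
    e : ∀ c n → (c + 1ℤ) * 1ℤ - 1ℤ - n ≡ c - n
    e = solve-∀
  U-reflect (suc j) c l n g = begin
    ∑ h (c + 1ℤ - l) (q̄ + 1ℤ)                    ≡⟨ ∑-flip h (c + 1ℤ - l) (q̄ + 1ℤ) ⟩
    - ∑ h (q̄ + 1ℤ) (c + 1ℤ - l)                  ≡⟨ cong (λ z → - ∑ h z (c + 1ℤ - l)) (e₁ c q̄) ⟩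
    - ∑ h (c + 1ℤ - (c - q̄)) (c + 1ℤ - l)        ≡⟨ cong -_ (∑-reflect h c l (c - q̄)) ⟨
    - ∑ (λ m → h (c - m)) l (c - q̄)              ≡⟨ cong -_ (∑-cong step l (c - q̄)) ⟩
    - ∑ (λ m → sgn j * k m) l (c - q̄)            ≡⟨ cong -_ (∑-* (sgn j) k l (c - q̄)) ⟩
    - (sgn j * ∑ k l (c - q̄))                    ≡⟨ cong (λ z → - (sgn j * z)) (∑-split k l (q + 1ℤ) (c - q̄)) ⟩
    - (sgn j * (∑ k l (q + 1ℤ) + ∑ k (q + 1ℤ) (c - q̄)))
      ≡⟨ cong (λ z → - (sgn j * (∑ k l (q + 1ℤ) + z))) excess ⟩
    - (sgn j * (∑ k l (q + 1ℤ) + 0ℤ))             ≡⟨ e₂ (sgn j) (∑ k l (q + 1ℤ)) ⟩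
    sgn (suc j) * ∑ k l (q + 1ℤ)                  ∎
    where
    d = suc (suc j)
    n̄ = (c + 1ℤ) * + d - τ (suc j) - n
    q = n /ℕ d
    q̄ = n̄ /ℕ d
    h k : ℤ → ℤ
    h p = U j p (n̄ - p) (λ v → g (p ∷ v))
    k p = U j p (n - p) (λ v → g (reflect c (p ∷ v)))
    e₁ : ∀ c q → q + 1ℤ ≡ c + 1ℤ - (c - q)
    e₁ = solve-∀
    e₂ : ∀ a b → - (a * (b + 0ℤ)) ≡ -1ℤ * a * b
    e₂ = solve-∀
    e₃ : ∀ c m → c - m ≡ c - 1ℤ + 1ℤ - m
    e₃ = solve-∀
    e₄ : ∀ c n m w t → (c + 1ℤ) * (1ℤ + w) - (t + (1ℤ + w)) - n - (c - m) ≡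
                       (c - 1ℤ + 1ℤ) * w - t - (n - m)
    e₄ = solve-∀
    e₅ : ∀ n m w → m * w - (n - m + 1ℤ) ≡ m * (1ℤ + w) - (n + 1ℤ)
    e₅ = solve-∀
    e₆ : ∀ c m q → c - m - (q + 1ℤ) ≡ c - q - (m + 1ℤ)
    e₆ = solve-∀
    e₇ : ∀ c n m w t → n - m + t - (m * w + 1ℤ) ≡
         (c - m) * (1ℤ + w) - ((c + 1ℤ) * (1ℤ + w) - (t + (1ℤ + w)) - n + 1ℤ)
    e₇ = solve-∀
    e₈ : ∀ m q → q - m ≡ q + 1ℤ - (m + 1ℤ)
    e₈ = solve-∀
    e₉ : ∀ c m q → q - (c - m) ≡ m - (c - q)
    e₉ = solve-∀
    e₁₀ : ∀ c n m w t → n + ((c + 1ℤ) * (1ℤ + w) - (t + (1ℤ + w)) - n) + t -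
                        (m * (1ℤ + w) + (c - m) * (1ℤ + w) + 1ℤ) ≡ -1ℤ
    e₁₀ = solve-∀
    step : ∀ m → h (c - m) ≡ sgn j * k m
    step m = trans (cong₂ (λ y z → U j y z (λ v → g ((c - m) ∷ v))) (e₃ c m) (e₄ c n m (+ suc j) (τ j)))
                   (U-reflect j (c - 1ℤ) m (n - m) (λ v → g ((c - m) ∷ v)))
    -- Rounding leaves a gap between the reflected interval and the wanted one.
    excess : ∑ k (q + 1ℤ) (c - q̄) ≡ 0ℤ
    excess = ∑-vanish k _ _
      (λ m q<m m<c → U-vanish j m (n - m) _
        (≤-from _ _ (/<⇒<* m n d q<m) (e₅ n m (+ suc j)))
        (≤-from _ _ (/<⇒<* (c - m) n̄ d (≤-from _ _ m<c (e₆ c m q̄))) (e₇ c n m (+ suc j) (τ j))))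
      -- Such an m would satisfy m d ≤ n and (c - m) d ≤ n̄, but n + n̄ = c d - `τ j` is less than c
      -- d.
      (λ m c≤m m≤q → ⊥-elim (≤-absurd 0
        (ℤ.+-mono-≤ (ℤ.+-mono-≤ (≤-/⇒*≤ m n d (≤-from m q m≤q (e₈ m q)))
                                (≤-/⇒*≤ (c - m) n̄ d (≤-from _ _ c≤m (e₉ c m q̄))))
                    (1≤τ j))
        (e₁₀ c n m (+ suc j) (τ j))))

  -- For v ≥ 0 increasing: the number of chains of K rows below v.
  f : ∀ {t} → ℕ → Vec ℤ t → ℤ
  f zero    v = 1ℤ
  f (suc K) v = T 0ℤ v (f K)

  -- For x < 0 the sum over the first entry m of the next row is reversed and runs over x < m < 0.
  -- There m ≥ -(K - 1), so the summands vanish by induction: the window loses one value with each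
  -- row.
  f-vanish : ∀ {t} K x (xs : Vec ℤ t) → - (+ K) ≤ x → x + 1ℤ ≤ 0ℤ → f K (x ∷ xs) ≡ 0ℤ
  f-vanish zero    x xs lo hi = ⊥-elim (≤-absurd 0 (ℤ.+-mono-≤ lo hi) (e x))
    where
    e : ∀ x → x + 0ℤ - (0ℤ + (x + 1ℤ)) ≡ -1ℤ
    e = solve-∀
  f-vanish (suc K) x xs lo hi = ∑-vanish _ 0ℤ (x + 1ℤ)
    (λ m 0≤m m≤x → ⊥-elim (≤-absurd 0 (ℤ.+-mono-≤ (ℤ.+-mono-≤ 0≤m m≤x) hi) (e₁ m x)))
    (λ m x<m m<0 → T-zero m xs λ v → f-vanish K m v
      (≤-from _ _ (ℤ.+-mono-≤ lo x<m) (e₂ m x (+ K))) m<0)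
    where
    e₁ : ∀ m x → m + (x + 1ℤ) + 0ℤ - (0ℤ + (m + 1ℤ) + (x + 1ℤ)) ≡ -1ℤ
    e₁ = solve-∀
    e₂ : ∀ m x K → m - (- K) ≡ x + m - (- (1ℤ + K) + (x + 1ℤ))
    e₂ = solve-∀

  -- The substitution m ↦ c - m with c = -1 - K sends the lower bound 0 to c + 1 = -K; by
  -- `f-vanish`, starting there adds only zero terms.
  T-f-lower : ∀ {t} K (v : Vec ℤ t) → T 0ℤ v (f K) ≡ T (- (+ K)) v (f K)
  T-f-lower K []       = refl
  T-f-lower K (x ∷ xs) = sym (begin
    ∑ h (- (+ K)) (x + 1ℤ)                      ≡⟨ ∑-split h (- (+ K)) 0ℤ (x + 1ℤ) ⟩
    ∑ h (- (+ K)) 0ℤ + ∑ h 0ℤ (x + 1ℤ)          ≡⟨ cong (_+ ∑ h 0ℤ (x + 1ℤ)) (∑-vanish h (- (+ K)) 0ℤ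
        (λ m lo hi → T-zero m xs λ v → f-vanish K m v lo hi)
        (λ m 0≤m m<K → ⊥-elim (≤-absurd 0 (ℤ.+-mono-≤ (ℤ.+-mono-≤ 0≤m m<K) (+≤+ (z≤n {K}))) (e m (+ K))))) ⟩
    0ℤ + ∑ h 0ℤ (x + 1ℤ)                        ≡⟨ ℤ.+-identityˡ _ ⟩
    ∑ h 0ℤ (x + 1ℤ)                             ∎)
    where
    h : ℤ → ℤ
    h m = T m xs (λ v → f K (m ∷ v))
    e : ∀ m K → m + - K + K - (0ℤ + (m + 1ℤ) + 0ℤ) ≡ -1ℤ
    e = solve-∀

  -- A row with `K` rows below it is reflected with constants starting at -1 - K, one lower than for
  -- the row beneath. Each of the `K * t` summations is reversed once.
  f-reflect : ∀ {t} K (v : Vec ℤ t) → f K (reflect (-1ℤ - + K) v) ≡ sgn (K ℕ.* t) * f K v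
  f-reflect zero        v = refl
  f-reflect {t} (suc K) v = begin
    T 0ℤ (reflect (-1ℤ - + suc K) v) (f K)           ≡⟨ cong (λ z → T 0ℤ (reflect z v) (f K)) (e₁ (+ K)) ⟩
    T 0ℤ (reflect (c - 1ℤ) v) (f K)                  ≡⟨ T-f-lower K (reflect (c - 1ℤ) v) ⟩
    T (- (+ K)) (reflect (c - 1ℤ) v) (f K)           ≡⟨ cong (λ z → T z (reflect (c - 1ℤ) v) (f K)) (e₂ (+ K)) ⟩
    T (c + 1ℤ - 0ℤ) (reflect (c - 1ℤ) v) (f K)       ≡⟨ T-reflect c 0ℤ v (f K) ⟩
    sgn t * T 0ℤ v (λ w → f K (reflect c w))         ≡⟨ cong (sgn t *_) (T-cong 0ℤ v (f-reflect K)) ⟩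
    sgn t * T 0ℤ v (λ w → sgn (K ℕ.* t) * f K w)     ≡⟨ cong (sgn t *_) (T-* (sgn (K ℕ.* t)) 0ℤ v (f K)) ⟩
    sgn t * (sgn (K ℕ.* t) * T 0ℤ v (f K))           ≡⟨ ℤ.*-assoc (sgn t) (sgn (K ℕ.* t)) (T 0ℤ v (f K)) ⟨
    sgn t * sgn (K ℕ.* t) * T 0ℤ v (f K)             ≡⟨ cong (_* T 0ℤ v (f K)) (ℤ.^-distribˡ-+-* -1ℤ t (K ℕ.* t)) ⟨
    sgn (t ℕ.+ K ℕ.* t) * T 0ℤ v (f K)               ∎
    where
    c = -1ℤ - + K
    e₁ : ∀ K → -1ℤ - (1ℤ + K) ≡ -1ℤ - K - 1ℤ
    e₁ = solve-∀
    e₂ : ∀ K → - K ≡ -1ℤ - K + 1ℤ - 0ℤ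
    e₂ = solve-∀

  -- A K j (+ n) is α (suc K) (suc j) n, by α≡A.
  A : ℕ → ℕ → ℤ → ℤ
  A K j n = U j 0ℤ n (f K)

  -- r (r - 1 + 2 k) / 2 for k = K + 1 and r = j + 1
  shift : ℕ → ℕ → ℤ
  shift K j = τ j + + K * + suc j

  U-f-lower : ∀ K j n → U j 0ℤ n (f K) ≡ U j (- (+ K)) n (f K)
  U-f-lower K zero    n = refl
  U-f-lower K (suc j) n = sym (begin
    ∑ h (- (+ K)) q                      ≡⟨ ∑-split h (- (+ K)) 0ℤ q ⟩
    ∑ h (- (+ K)) 0ℤ + ∑ h 0ℤ q          ≡⟨ cong (_+ ∑ h 0ℤ q) (∑-vanish h (- (+ K)) 0ℤ
        (λ m lo hi → U-zero j m (n - m) λ v → f-vanish K m v lo hi)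
        (λ m 0≤m m<K → ⊥-elim (≤-absurd 0 (ℤ.+-mono-≤ (ℤ.+-mono-≤ 0≤m m<K) (+≤+ (z≤n {K}))) (e m (+ K))))) ⟩
    0ℤ + ∑ h 0ℤ q                        ≡⟨ ℤ.+-identityˡ _ ⟩
    ∑ h 0ℤ q                             ∎)
    where
    q = n /ℕ suc (suc j) + 1ℤ
    h : ℤ → ℤ
    h p = U j p (n - p) (λ v → f K (p ∷ v))
    e : ∀ m K → m + - K + K - (0ℤ + (m + 1ℤ) + 0ℤ) ≡ -1ℤ
    e = solve-∀

  -- `U-reflect` with c = -1 - K sends n to -K (j + 1) - `τ j` - n; this is the origin of the
  -- exponent in the theorem. The sign is that of k r - 1 reversals, since the largest entry of the
  -- first row is not summed over.
  A-reflect : ∀ K j n → A K j (- shift K j - n) ≡ sgn (j ℕ.+ K ℕ.* suc j) * A K j n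
  A-reflect K j n = begin
    U j 0ℤ (- shift K j - n) (f K)          ≡⟨ U-f-lower K j _ ⟩
    U j (- (+ K)) (- shift K j - n) (f K)   ≡⟨ cong₂ (λ y z → U j y z (f K)) (e₁ (+ K)) (e₂ (+ K) (+ suc j) (τ j) n) ⟩
    U j (c + 1ℤ - 0ℤ) ((c + 1ℤ) * + suc j - τ j - n) (f K)
                                            ≡⟨ U-reflect j c 0ℤ n (f K) ⟩
    sgn j * U j 0ℤ n (λ w → f K (reflect c w))
                                            ≡⟨ cong (sgn j *_) (U-cong j 0ℤ n (f-reflect K)) ⟩
    sgn j * U j 0ℤ n (λ w → sgn (K ℕ.* suc j) * f K w)
                                            ≡⟨ cong (sgn j *_) (U-* j (sgn (K ℕ.* suc j)) 0ℤ n (f K)) ⟩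
    sgn j * (sgn (K ℕ.* suc j) * A K j n)   ≡⟨ ℤ.*-assoc (sgn j) (sgn (K ℕ.* suc j)) (A K j n) ⟨
    sgn j * sgn (K ℕ.* suc j) * A K j n     ≡⟨ cong (_* A K j n) (ℤ.^-distribˡ-+-* -1ℤ j (K ℕ.* suc j)) ⟨
    sgn (j ℕ.+ K ℕ.* suc j) * A K j n       ∎
    where
    c = -1ℤ - + K
    e₁ : ∀ K → - K ≡ -1ℤ - K + 1ℤ - 0ℤ
    e₁ = solve-∀
    e₂ : ∀ K w t n → - (t + K * w) - n ≡ (-1ℤ - K + 1ℤ) * w - t - n
    e₂ = solve-∀

  -- For n < 0 the outermost sum is reversed and meets only negative m. If m ≥ -K, the factor `f K`
  -- vanishes; if m < -K, the bound n > -s leaves a total n - m that lies in the window of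
  -- `U-vanish`.
  A-vanish : ∀ K j n → - shift K j + 1ℤ ≤ n → n + 1ℤ ≤ 0ℤ → A K j n ≡ 0ℤ
  A-vanish K zero    n lo hi = f-vanish K n [] (≤-from _ _ lo (e (+ K) n)) hi
    where
    e : ∀ K n → n - (- K) ≡ n - (- (1ℤ + K * 1ℤ) + 1ℤ)
    e = solve-∀
  A-vanish K (suc j) n lo hi = ∑-vanish _ 0ℤ _
    (λ m 0≤m m≤q → ⊥-elim (≤-absurd 0
      (ℤ.+-mono-≤ (ℤ.+-mono-≤ (ℤ.*-monoʳ-≤-nonNeg (+ d) 0≤m) hi)
                  (≤-/⇒*≤ m n d (≤-from _ _ m≤q (e₁ m (n /ℕ d)))))
      (e₂ n (+ d) (m * + d))))
    below
    where
    d = suc (suc j)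
    e₁ : ∀ m q → q - m ≡ q + 1ℤ - (m + 1ℤ)
    e₁ = solve-∀
    e₂ : ∀ n d x → x + 0ℤ + n - (0ℤ + (n + 1ℤ) + x) ≡ -1ℤ
    e₂ = solve-∀
    e₃ : ∀ n m w → m * w - (n - m + 1ℤ) ≡ m * (1ℤ + w) - (n + 1ℤ)
    e₃ = solve-∀
    e₄ : ∀ n m w t K → n - m + t - (m * w + 1ℤ) ≡
         - K * (1ℤ + w) + n - ((m + 1ℤ) * (1ℤ + w) + (- (t + (1ℤ + w) + K * (1ℤ + w)) + 1ℤ))
    e₄ = solve-∀
    below : ∀ m → n /ℕ d + 1ℤ ≤ m → m + 1ℤ ≤ 0ℤ → U j m (n - m) (λ v → f K (m ∷ v)) ≡ 0ℤ
    below m q<m m<0 with - (+ K) ℤ.≤? m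
    ... | yes p = U-zero j m (n - m) λ v → f-vanish K m v p m<0
    ... | no ¬p = U-vanish j m (n - m) _
      (≤-from _ _ (/<⇒<* m n d q<m) (e₃ n m (+ suc j)))
      (≤-from _ _ (ℤ.+-mono-≤ (ℤ.*-monoʳ-≤-nonNeg (+ d) (<⇒+1≤ (ℤ.≰⇒> ¬p))) lo) (e₄ n m (+ suc j) (τ j) (+ K)))

open Reflection

-- Quasi-polynomials

module QuasiPolynomials where
  open import Data.Integer.Base using (_+_; _*_; _≤_)

  -- move M u is the translation by M u. Only the translations enter the definition of QuasiPoly, and
  -- any map that carries translations to translations pulls quasi-polynomials back; this covers both
  -- substitution of linear forms and n ↦ ⌊n / k⌋, which maps steps of k M to steps of M.
  record Space : Set₁ where
    field
      Point Dir  : Set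
      move       : ℕ → Dir → Point → Point
      scale      : ℕ → Dir → Dir
      move-scale : ∀ j M u x → move (j ℕ.* M) u x ≡ move M (scale j u) x

  open Space

  line : Space
  line = record
    { Point = ℤ ; Dir = ℤ
    ; move = λ M u x → x + + M * u
    ; scale = λ j u → + j * u
    ; move-scale = λ j M u x → cong (λ z → x + z) (trans (cong (_* u) (ℤ.pos-* j M)) (swap (+ j) (+ M) u)) }
    where
    swap : ∀ j M u → j * M * u ≡ M * (j * u)
    swap = solve-∀

  point : Space
  point = record
    { Point = ⊤ ; Dir = ⊤ ; move = λ _ _ _ → tt ; scale = λ _ _ → tt ; move-scale = λ _ _ _ _ → refl }

  infixr 5 _⊗_
  _⊗_ : Space → Space → Space
  X ⊗ Y = record
    { Point = Point X × Point Y ; Dir = Dir X × Dir Y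
    ; move = λ M (u , v) (x , y) → move X M u x , move Y M v y
    ; scale = λ j (u , v) → scale X j u , scale Y j v
    ; move-scale = λ j M (u , v) (x , y) → cong₂ _,_ (move-scale X j M u x) (move-scale Y j M v y) }

  vecSpace : ℕ → Space
  vecSpace t = record
    { Point = Vec ℤ t ; Dir = Vec ℤ t
    ; move = λ M → zipWith (λ u x → move line M u x)
    ; scale = λ j → Vec.map (λ u → + j * u)
    ; move-scale = vec-move-scale }
    where
    vec-move-scale : ∀ {t} j M (u x : Vec ℤ t) → zipWith (move line (j ℕ.* M)) u x ≡
      zipWith (move line M) (Vec.map (λ u → + j * u) u) x
    vec-move-scale j M []      []      = refl
    vec-move-scale j M (u ∷ us) (x ∷ xs) = cong₂ _∷_ (move-scale line j M u x) (vec-move-scale j M us xs)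

  -- All d-fold differences along translations by multiples of M vanish.
  data QuasiPoly (X : Space) (M : ℕ) : ℕ → (Point X → ℤ) → Set where
    zero : ∀ {h} → (∀ x → h x ≡ 0ℤ) → QuasiPoly X M zero h
    suc  : ∀ {d h} → (∀ u → QuasiPoly X M d (λ x → h (move X M u x) - h x)) → QuasiPoly X M (suc d) h

  private
    variable
      X Y : Space
      M N d : ℕ

  qp-cong : ∀ {h h′ : Point X → ℤ} → h ≗ h′ → QuasiPoly X M d h → QuasiPoly X M d h′
  qp-cong e (zero q) = zero λ x → trans (sym (e x)) (q x)
  qp-cong e (suc q)  = suc λ u → qp-cong (λ x → cong₂ _-_ (e _) (e x)) (q u)

  qp-zero : ∀ {h : Point X → ℤ} d → (∀ x → h x ≡ 0ℤ) → QuasiPoly X M d h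
  qp-zero zero    z = zero z
  qp-zero (suc d) z = suc λ u → qp-zero d λ x → cong₂ _-_ (z _) (z x)

  qp-suc : ∀ {h : Point X → ℤ} → QuasiPoly X M d h → QuasiPoly X M (suc d) h
  qp-suc (zero q) = qp-zero 1 q
  qp-suc (suc q)  = suc λ u → qp-suc (q u)

  qp-+ : ∀ {h h′ : Point X → ℤ} → QuasiPoly X M d h → QuasiPoly X M d h′ → QuasiPoly X M d (λ x → h x + h′ x)
  qp-+ (zero q) (zero q′) = zero λ x → cong₂ _+_ (q x) (q′ x)
  qp-+ {X} {M} {h = h} {h′ = h′} (suc q) (suc q′) = suc λ u →
    qp-cong (λ x → e (h (move X M u x)) (h x) (h′ (move X M u x)) (h′ x)) (qp-+ (q u) (q′ u))
    where
    e : ∀ a b c d → (a - b) + (c - d) ≡ (a + c) - (b + d)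
    e = solve-∀

  qp-neg : ∀ {h : Point X → ℤ} → QuasiPoly X M d h → QuasiPoly X M d (λ x → - h x)
  qp-neg (zero q) = zero λ x → cong -_ (q x)
  qp-neg {X} {M} {h = h} (suc q) = suc λ u → qp-cong (λ x → e (h (move X M u x)) (h x)) (qp-neg (q u))
    where
    e : ∀ a b → - (a - b) ≡ (- a) - (- b)
    e = solve-∀

  qp-move : ∀ {h : Point X → ℤ} u → QuasiPoly X M d h → QuasiPoly X M d (λ x → h (move X M u x))
  qp-move u (zero q) = zero λ x → q _
  qp-move {X} {M} {h = h} u (suc q) = qp-cong (λ x → e (h x) (h (move X M u x))) (qp-+ {h = h} (suc q) (qp-suc (q u)))
    where
    e : ∀ a b → a + (b - a) ≡ b
    e = solve-∀

  qp-pullback : ∀ {h : Point Y → ℤ} (φ : Point X → Point Y) (ψ : Dir X → Dir Y) →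
                (∀ u x → φ (move X M u x) ≡ move Y N (ψ u) (φ x)) →
                QuasiPoly Y N d h → QuasiPoly X M d (λ x → h (φ x))
  qp-pullback φ ψ e (zero q) = zero λ x → q _
  qp-pullback {h = h} φ ψ e (suc q) = suc λ u →
    qp-cong (λ x → cong (λ y → h y - h (φ x)) (sym (e u x))) (qp-pullback φ ψ e (q (ψ u)))

  -- A fixed bound means a fixed finite number of slices, so the degree does not rise.
  qp-antidiff-fixed : (h : Point X → ℤ → ℤ) → (∀ i → QuasiPoly X M d (λ x → h x i)) →
                      ∀ z → QuasiPoly X M d (λ x → antidiff (h x) z)
  qp-antidiff-fixed h q (+ zero)     = qp-zero _ λ _ → refl
  qp-antidiff-fixed h q (+ suc n)    = qp-+ (qp-antidiff-fixed h q (+ n)) (q (+ n))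
  qp-antidiff-fixed h q -[1+ zero ]  = qp-neg (q -[1+ 0 ])
  qp-antidiff-fixed h q -[1+ suc n ] = qp-+ (qp-antidiff-fixed h q -[1+ n ]) (qp-neg (q -[1+ suc n ]))

  -- The difference along (u, v) splits into a sum with the fixed bound M v, covered by
  -- `qp-antidiff-fixed`, and the sum up to b of the differences of `h`, covered by induction.
  qp-antidiff : (h : Point X → ℤ → ℤ) → QuasiPoly (X ⊗ line) M d (λ (x , m) → h x m) →
                QuasiPoly (X ⊗ line) M (suc d) (λ (x , b) → antidiff (h x) b)
  qp-antidiff h (zero q) = qp-zero 1 λ (x , b) →
    trans (antidiff-cong (λ m → q (x , m)) b) (antidiff-* 0ℤ (λ _ → 0ℤ) b)
  qp-antidiff {X} {M} {suc d} h (suc q) = suc λ (u , v) → qp-cong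
    (λ (x , b) → trans (cong (λ z → antidiff (h (move X M u x)) (+ M * v) + z)
                          (trans (antidiff-- (λ m → h (move X M u x) (m + + M * v)) (h x) b)
                                 (cong (_- antidiff (h x) b) (antidiff-shift (h (move X M u x)) (+ M * v) b))))
                       (e (antidiff (h (move X M u x)) (+ M * v)) (antidiff (h (move X M u x)) (b + + M * v)) (antidiff (h x) b)))
    (qp-+
      (qp-antidiff-fixed (λ (x , b) m → h (move X M u x) m) (fixed u) (+ M * v))
      (qp-antidiff (λ x m → h (move X M u x) (m + + M * v) - h x m) (q (u , v))))
    where
    e : ∀ a b c → a + (b - a - c) ≡ b - c
    e = solve-∀
    still : ∀ i → i + + M * 0ℤ ≡ i
    still i = trans (cong (λ z → i + z) (ℤ.*-zeroʳ (+ M))) (ℤ.+-identityʳ i)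
    fixed : ∀ u i → QuasiPoly (X ⊗ line) M (suc d) (λ (x , b) → h (move X M u x) i)
    fixed u i = qp-pullback {Y = X ⊗ line} {h = λ (x , b) → h (move X M u x) b} (λ (x , b) → x , i) (λ (w , z) → w , 0ℤ)
      (λ (w , z) (x , b) → cong (_ ,_) (sym (still i)))
      (qp-cong (λ (x , b) → cong (h (move X M u x)) (still b)) (qp-move {h = λ (x , b) → h x b} (u , 0ℤ) (suc q)))

  -- Two moduli allow for a bound like ⌊n / k⌋, which moves by multiples of M when n moves by
  -- multiples of k M.
  qp-∑ : (h : Point X → ℤ → ℤ) (x : Point Y → Point X) (a b : Point Y → ℤ)
         (u : Dir Y → Dir X) (v w : Dir Y → ℤ) →
         (∀ z y → x (move Y N z y) ≡ move X M (u z) (x y)) →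
         (∀ z y → a (move Y N z y) ≡ move line M (v z) (a y)) →
         (∀ z y → b (move Y N z y) ≡ move line M (w z) (b y)) →
         QuasiPoly (X ⊗ line) M d (λ (x , m) → h x m) →
         QuasiPoly Y N (suc d) (λ y → ∑ (h (x y)) (a y) (b y))
  qp-∑ {X} h x a b u v w eu ev ew q = qp-+
    (qp-pullback {Y = X ⊗ line} (λ y → x y , b y) (λ z → u z , w z)
      (λ z y → cong₂ _,_ (eu z y) (ew z y)) (qp-antidiff h q))
    (qp-neg (qp-pullback {Y = X ⊗ line} (λ y → x y , a y) (λ z → u z , v z)
      (λ z y → cong₂ _,_ (eu z y) (ev z y)) (qp-antidiff h q)))

  private
    swap : ∀ y z → y + z + 1ℤ ≡ y + 1ℤ + z
    swap = solve-∀

  -- `X` collects the entries chosen so far, on which `g` may depend; this makes the induction go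
  -- through, at the cost of one degree per summation.
  qp-T : ∀ t (g : Point X → Vec ℤ t → ℤ) → QuasiPoly (X ⊗ vecSpace t) M d (λ (x , v) → g x v) →
         QuasiPoly (X ⊗ line ⊗ vecSpace t) M (t ℕ.+ d) (λ (x , l , v) → T l v (g x))
  qp-T {X} zero    g q = qp-cong (λ { (x , l , []) → refl })
    (qp-pullback {Y = X ⊗ vecSpace 0} (λ (x , l , v) → x , v) (λ (x , l , v) → x , v) (λ _ _ → refl) q)
  qp-T {X} {M} (suc t) g q = qp-cong (λ { (x , l , y ∷ ys) → refl })
    (qp-∑ {X = X ⊗ vecSpace t} (λ (x , ys) m → T m ys (λ v → g x (m ∷ v)))
      (λ (x , l , v) → x , tail v) (λ (x , l , v) → l) (λ (x , l , v) → head v + 1ℤ)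
      (λ (x , l , v) → x , tail v) (λ (x , l , v) → l) (λ (x , l , v) → head v)
      (λ { (_ , _ , _ ∷ _) (_ , _ , _ ∷ _) → refl })
      (λ _ _ → refl)
      (λ { (_ , _ , v ∷ _) (_ , _ , y ∷ _) → swap y (+ M * v) })
      (qp-pullback {Y = (X ⊗ line) ⊗ line ⊗ vecSpace t}
        (λ ((x , ys) , m) → (x , m) , m , ys) (λ ((x , ys) , m) → (x , m) , m , ys) (λ _ _ → refl)
        (qp-T {X = X ⊗ line} t (λ (x , m) v → g x (m ∷ v))
          (qp-pullback {Y = X ⊗ vecSpace (suc t)}
            (λ ((x , m) , v) → x , m ∷ v) (λ ((x , m) , v) → x , m ∷ v) (λ _ _ → refl) q))))

  -- This is (j + 1)! M: the quotients by 2, ..., j + 1 in `U j` are nested.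
  period : ℕ → ℕ → ℕ
  period M zero    = M
  period M (suc j) = suc (suc j) ℕ.* period M j

  /ℕ-unique : ∀ n d q .{{_ : ℕ.NonZero d}} → q * + d ≤ n → n + 1ℤ ≤ (q + 1ℤ) * + d → n /ℕ d ≡ q
  /ℕ-unique n d q lo hi = ℤ.≤-antisym
    (≤-from _ _ (<*⇒/< (q + 1ℤ) n d hi) (e q (n /ℕ d)))
    (*≤⇒≤-/ q n d lo)
    where
    e : ∀ q x → q - x ≡ q + 1ℤ - (x + 1ℤ)
    e = solve-∀

  /ℕ-shift : ∀ n d z .{{_ : ℕ.NonZero d}} → (n + + d * z) /ℕ d ≡ n /ℕ d + z
  /ℕ-shift n d z = /ℕ-unique (n + + d * z) d (n /ℕ d + z)
    (≤-from _ _ (≤-/⇒*≤ (n /ℕ d) n d ℤ.≤-refl) (e₁ n (+ d) z (n /ℕ d)))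
    (≤-from _ _ (/<⇒<* (n /ℕ d + 1ℤ) n d ℤ.≤-refl) (e₂ n (+ d) z (n /ℕ d)))
    where
    e₁ : ∀ n d z q → n + d * z - (q + z) * d ≡ n - q * d
    e₁ = solve-∀
    e₂ : ∀ n d z q → (q + z + 1ℤ) * d - (n + d * z + 1ℤ) ≡ (q + 1ℤ) * d - (n + 1ℤ)
    e₂ = solve-∀

  qp-U : ∀ j (g : Point X → Vec ℤ (suc j) → ℤ) → QuasiPoly (X ⊗ vecSpace (suc j)) M d (λ (x , v) → g x v) →
         QuasiPoly (X ⊗ line ⊗ line) (period M j) (j ℕ.+ d) (λ (x , l , n) → U j l n (g x))
  qp-U {X} zero    g q = qp-pullback {Y = X ⊗ vecSpace 1}
    (λ (x , l , n) → x , n ∷ []) (λ (x , l , n) → x , n ∷ []) (λ _ _ → refl) q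
  qp-U {X} {M} (suc j) g q =
    qp-∑ {X = X ⊗ line} (λ (x , n) p → U j p (n - p) (λ v → g x (p ∷ v)))
      (λ (x , l , n) → x , n) (λ (x , l , n) → l) (λ (x , l , n) → n /ℕ k + 1ℤ)
      -- It takes a step of k P in n to move the quotient by P; for the other coordinates this
      -- counts as k steps of P.
      (λ (x , l , n) → scale X k x , scale line k n) (λ (x , l , n) → scale line k l) (λ (x , l , n) → n)
      (λ (u , _ , w) (x , _ , n) → cong₂ _,_ (move-scale X k P u x) (move-scale line k P w n))
      (λ (_ , w , _) (_ , l , _) → move-scale line k P w l)
      (λ (_ , _ , w) (_ , _ , n) → begin
        (n + + (k ℕ.* P) * w) /ℕ k + 1ℤ   ≡⟨ cong (λ z → (n + z) /ℕ k + 1ℤ) (trans (cong (_* w) (ℤ.pos-* k P)) (ℤ.*-assoc (+ k) (+ P) w)) ⟩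
        (n + + k * (+ P * w)) /ℕ k + 1ℤ   ≡⟨ cong (_+ 1ℤ) (/ℕ-shift n k (+ P * w)) ⟩
        n /ℕ k + + P * w + 1ℤ             ≡⟨ swap (n /ℕ k) (+ P * w) ⟩
        n /ℕ k + 1ℤ + + P * w             ∎)
      (qp-pullback {Y = (X ⊗ line) ⊗ line ⊗ line}
        (λ ((x , n) , p) → (x , p) , p , n - p) (λ ((x , n) , p) → (x , p) , p , n - p)
        (λ ((u , w) , v) ((x , n) , p) → cong (λ z → (move X P u x , p + + P * v) , p + + P * v , z) (e n p (+ P) w v))
        (qp-U {X = X ⊗ line} j (λ (x , p) v → g x (p ∷ v))
          (qp-pullback {Y = X ⊗ vecSpace (suc (suc j))}
            (λ ((x , m) , v) → x , m ∷ v) (λ ((x , m) , v) → x , m ∷ v) (λ _ _ → refl) q)))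
    where
    k = suc (suc j)
    P = period M j
    e : ∀ n p a w v → n + a * w - (p + a * v) ≡ n - p + a * (w - v)
    e = solve-∀

  -- No quotient occurs below the first row, hence the modulus 1. The number of differences is one
  -- per summation and one more for the constant at the bottom.
  qp-f : ∀ K t → QuasiPoly (vecSpace t) 1 (K ℕ.* t ℕ.+ 1) (f K)
  qp-f zero    t = suc λ u → zero λ x → refl
  qp-f (suc K) t = subst (λ d → QuasiPoly (vecSpace t) 1 d (f (suc K))) (sym (ℕ.+-assoc t (K ℕ.* t) 1))
    (qp-pullback {Y = point ⊗ line ⊗ vecSpace t} {N = 1} (λ v → tt , 0ℤ , v) (λ v → tt , 0ℤ , v) (λ _ _ → refl)
      (qp-T {X = point} t (λ _ → f K)
        (qp-pullback (λ (_ , v) → v) (λ (_ , v) → v) (λ _ _ → refl) (qp-f K t))))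

  qp-A : ∀ K j → ∃[ d ] QuasiPoly line (period 1 j) d (A K j)
  qp-A K j = _ , qp-pullback {Y = point ⊗ line ⊗ line}
    (λ n → tt , 0ℤ , n) (λ n → tt , 0ℤ , n)
    (λ u n → cong (λ z → tt , z , n + + period 1 j * u) (sym (trans (ℤ.+-identityˡ _) (ℤ.*-zeroʳ (+ period 1 j)))))
    (qp-U {X = point} j (λ _ → f K)
        (qp-pullback (λ (_ , v) → v) (λ (_ , v) → v) (λ _ _ → refl) (qp-f K (suc j))))

open QuasiPolynomials

-- The numerator

module Convolution where
  open import Data.Integer.Base using (_+_; _*_; _≤_)

  -- δ M d i is the coefficient of xⁱ in (1 - x^M)^d.
  δ : ℕ → ℕ → ℤ → ℤ
  δ M zero    (+ zero)  = 1ℤ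
  δ M zero    (+ suc _) = 0ℤ
  δ M zero    -[1+ _ ]  = 0ℤ
  δ M (suc d) i         = δ M d i - δ M d (i - + M)

  deg : ℕ → ℕ → ℤ
  deg M d = + (d ℕ.* M)

  δ-low : ∀ M d i → i + 1ℤ ≤ 0ℤ → δ M d i ≡ 0ℤ
  δ-low M zero    (+ n)    p = ⊥-elim (≤-absurd 0 (ℤ.+-mono-≤ p (+≤+ (z≤n {n}))) (e (+ n)))
    where
    e : ∀ n → 0ℤ + n - (n + 1ℤ + 0ℤ) ≡ -1ℤ
    e = solve-∀
  δ-low M zero    -[1+ _ ] p = refl
  δ-low M (suc d) i        p = cong₂ _-_ (δ-low M d i p)
    (δ-low M d (i - + M) (≤-from _ _ (ℤ.+-mono-≤ p (+≤+ (z≤n {M}))) (e i (+ M))))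
    where
    e : ∀ i M → 0ℤ - (i - M + 1ℤ) ≡ 0ℤ + M - (i + 1ℤ + 0ℤ)
    e = solve-∀

  δ-reflect : ∀ M d i → δ M d (deg M d - i) ≡ sgn d * δ M d i
  δ-reflect M zero    (+ zero)  = refl
  δ-reflect M zero    (+ suc n) = refl
  δ-reflect M zero    -[1+ n ]  = refl
  δ-reflect M (suc d) i = begin
    δ M d (+ M + D - i) - δ M d (+ M + D - i - + M)   ≡⟨ cong₂ (λ y z → δ M d y - δ M d z) (e₁ (+ M) D i) (e₂ (+ M) D i) ⟩
    δ M d (D - (i - + M)) - δ M d (D - i)             ≡⟨ cong₂ _-_ (δ-reflect M d (i - + M)) (δ-reflect M d i) ⟩
    sgn d * δ M d (i - + M) - sgn d * δ M d i         ≡⟨ e₃ (sgn d) (δ M d (i - + M)) (δ M d i) ⟩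
    sgn (suc d) * (δ M d i - δ M d (i - + M))         ∎
    where
    D = deg M d
    e₁ : ∀ M D i → M + D - i ≡ D - (i - M)
    e₁ = solve-∀
    e₂ : ∀ M D i → M + D - i - M ≡ D - i
    e₂ = solve-∀
    e₃ : ∀ s x y → s * x - s * y ≡ -1ℤ * s * (y - x)
    e₃ = solve-∀

  δ-high : ∀ M d i → deg M d + 1ℤ ≤ i → δ M d i ≡ 0ℤ
  δ-high M d i p = begin
    δ M d i                   ≡⟨ cong (δ M d) (e₁ (deg M d) i) ⟩
    δ M d (deg M d - (deg M d - i)) ≡⟨ δ-reflect M d (deg M d - i) ⟩
    sgn d * δ M d (deg M d - i)     ≡⟨ cong (sgn d *_) (δ-low M d _ (≤-from _ _ p (e₂ (deg M d) i))) ⟩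
    sgn d * 0ℤ                ≡⟨ ℤ.*-zeroʳ (sgn d) ⟩
    0ℤ                        ∎
    where
    e₁ : ∀ D i → i ≡ D - (D - i)
    e₁ = solve-∀
    e₂ : ∀ D i → 0ℤ - (D - i + 1ℤ) ≡ i - (D + 1ℤ)
    e₂ = solve-∀

  δ-zero : ∀ M d .{{_ : ℕ.NonZero M}} → δ M d 0ℤ ≡ 1ℤ
  δ-zero M       zero    = refl
  δ-zero (suc m) (suc d) = cong₂ _-_ (δ-zero (suc m) d) (δ-low (suc m) d _ (≤-from _ _ (+≤+ (z≤n {m})) (e (+ m))))
    where
    e : ∀ m → 0ℤ - (0ℤ - (1ℤ + m) + 1ℤ) ≡ m - 0ℤ
    e = solve-∀

  private
    term : ℕ → ℕ → (ℤ → ℤ) → ℤ → ℤ → ℤ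
    term M d A n i = δ M d i * A (n - i)

  term-low : ∀ M d A n i → i + 1ℤ ≤ 0ℤ → term M d A n i ≡ 0ℤ
  term-low M d A n i p = cong (_* A (n - i)) (δ-low M d i p)

  term-high : ∀ M d A n i → deg M d + 1ℤ ≤ i → term M d A n i ≡ 0ℤ
  term-high M d A n i p = cong (_* A (n - i)) (δ-high M d i p)

  -- The coefficient of xⁿ in the product of (1 - x^M)^d with the two-sided series of `A`: terms
  -- with n - i < 0 are included.
  conv : ℕ → ℕ → (ℤ → ℤ) → ℤ → ℤ
  conv M d A n = ∑ (term M d A n) 0ℤ (deg M d + 1ℤ)

  <-absurd : ∀ m a b n → m + 1ℤ ≤ a → b ≤ m → a + + n ≤ b → ⊥
  <-absurd m a b n p q r = ≤-absurd 0 (ℤ.+-mono-≤ (ℤ.+-mono-≤ p q) (ℤ.≤-trans (ℤ.i≤i+j a (+ n)) r)) (e m a b)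
    where
    e : ∀ m a b → a + m + b - (m + 1ℤ + b + a) ≡ -1ℤ
    e = solve-∀

  ∑-term-high : ∀ M d A n k → ∑ (term M d A n) (deg M d + 1ℤ) (deg M d + 1ℤ + + k) ≡ 0ℤ
  ∑-term-high M d A n k = ∑-vanish _ _ (deg M d + 1ℤ + + k)
    (λ i p _ → term-high M d A n i p)
    (λ i p q → ⊥-elim (<-absurd i (deg M d + 1ℤ) (deg M d + 1ℤ + + k) k q p ℤ.≤-refl))

  -- Multiplication by one more factor 1 - x^M. The intervals of summation differ only outside the
  -- support of `δ M d`.
  conv-suc : ∀ M d A n → conv M (suc d) A n ≡ conv M d A n - conv M d A (n - + M)
  conv-suc M d A n = begin
    ∑ (term M (suc d) A n) 0ℤ b               ≡⟨ ∑-cong expand 0ℤ b ⟩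
    ∑ (λ i → term M d A n i - k (i + z)) 0ℤ b ≡⟨ ∑-- (term M d A n) (λ i → k (i + z)) 0ℤ b ⟩
    ∑ (term M d A n) 0ℤ b - ∑ (λ i → k (i + z)) 0ℤ b
      ≡⟨ cong₂ _-_ first second ⟩
    conv M d A n - conv M d A (n - + M)       ∎
    where
    D = deg M d
    b = + M + D + 1ℤ
    z = - (+ M)
    k = term M d A (n - + M)
    expand : ∀ i → term M (suc d) A n i ≡ term M d A n i - k (i + z)
    expand i = trans (e (δ M d i) (δ M d (i - + M)) (A (n - i)))
      (cong (λ w → term M d A n i - δ M d (i - + M) * A w) (e′ n i (+ M)))
      where
      e : ∀ x y a → (x - y) * a ≡ x * a - y * a
      e = solve-∀
      e′ : ∀ n i M → n - i ≡ n - M - (i - M)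
      e′ = solve-∀
    first : ∑ (term M d A n) 0ℤ b ≡ conv M d A n
    first = trans (∑-split (term M d A n) 0ℤ (D + 1ℤ) b)
      (trans (cong (λ w → conv M d A n + w) (trans (cong (∑ (term M d A n) (D + 1ℤ)) (e (+ M) D)) (∑-term-high M d A n M)))
             (ℤ.+-identityʳ _))
      where
      e : ∀ M D → M + D + 1ℤ ≡ D + 1ℤ + M
      e = solve-∀
    second : ∑ (λ i → k (i + z)) 0ℤ b ≡ conv M d A (n - + M)
    second = trans (∑-shift k z 0ℤ b) (trans (cong (∑ k (0ℤ + z)) (e (+ M) D)) (trans (∑-split k (0ℤ + z) 0ℤ (D + 1ℤ))
      (trans (cong (_+ conv M d A (n - + M)) (∑-vanish k (0ℤ + z) 0ℤ
        (λ i _ p → term-low M d A (n - + M) i p)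
        (λ i p q → ⊥-elim (<-absurd i (0ℤ + z) 0ℤ M q p (ℤ.≤-reflexive (e′ (+ M)))))))
        (ℤ.+-identityˡ _))))
      where
      e : ∀ M D → M + D + 1ℤ + - M ≡ D + 1ℤ
      e = solve-∀
      e′ : ∀ M → 0ℤ + - M + M ≡ 0ℤ
      e′ = solve-∀

  conv-- : ∀ M d A B n → conv M d (λ x → A x - B x) n ≡ conv M d A n - conv M d B n
  conv-- M d A B n = trans (∑-cong (λ i → e (δ M d i) (A (n - i)) (B (n - i))) 0ℤ (deg M d + 1ℤ))
    (∑-- (term M d A n) (term M d B n) 0ℤ (deg M d + 1ℤ))
    where
    e : ∀ x a b → x * (a - b) ≡ x * a - x * b
    e = solve-∀

  -- Multiplying by 1 - x^M is, up to sign, taking the difference along the translation by -M, and d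
  -- such differences annihilate `A`.
  conv-quasiPoly : ∀ M d {A} → QuasiPoly line M d A → ∀ n → conv M d A n ≡ 0ℤ
  conv-quasiPoly M zero    {A} (zero q) n = ∑-vanish _ 0ℤ (deg M 0 + 1ℤ) (λ i _ _ → z i) (λ i _ _ → z i)
    where
    z : ∀ i → term M 0 A n i ≡ 0ℤ
    z i = trans (cong (δ M 0 i *_) (q (n - i))) (ℤ.*-zeroʳ (δ M 0 i))
  conv-quasiPoly M (suc d) {A} (suc q) n = begin
    conv M (suc d) A n                         ≡⟨ conv-suc M d A n ⟩
    conv M d A n - conv M d A (n - + M)        ≡⟨ e (conv M d A n) (conv M d A (n - + M)) ⟩
    - (conv M d A (n - + M) - conv M d A n)    ≡⟨ cong (λ w → - (w - conv M d A n)) (∑-cong (λ i → cong (λ w → δ M d i * A w) (e′ n i (+ M))) 0ℤ (deg M d + 1ℤ)) ⟩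
    - (conv M d (λ x → A (x + + M * -1ℤ)) n - conv M d A n)
                                               ≡⟨ cong -_ (conv-- M d (λ x → A (x + + M * -1ℤ)) A n) ⟨
    - conv M d (λ x → A (x + + M * -1ℤ) - A x) n
                                               ≡⟨ cong -_ (conv-quasiPoly M d (q -1ℤ) n) ⟩
    0ℤ                                         ∎
    where
    e : ∀ a b → a - b ≡ - (b - a)
    e = solve-∀
    e′ : ∀ n i M → n - M - i ≡ n - i + M * -1ℤ
    e′ = solve-∀

  -- The coefficients of the product of (1 - x^M)^d and the part of A on ℕ.
  ν : ℕ → ℕ → (ℤ → ℤ) → ℤ → ℤ
  ν M d A m = ∑ (term M d A m) 0ℤ (m + 1ℤ)

  ν-low : ∀ M d A m → m + 1ℤ ≤ 0ℤ → ν M d A m ≡ 0ℤ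
  ν-low M d A m p = ∑-vanish _ 0ℤ (m + 1ℤ)
    (λ i 0≤i i<m → ⊥-elim (≤-absurd 0 (ℤ.+-mono-≤ (ℤ.+-mono-≤ i<m p) 0≤i) (e i m)))
    (λ i _ i<0 → term-low M d A m i i<0)
    where
    e : ∀ i m → m + 1ℤ + 0ℤ + i - (i + 1ℤ + (m + 1ℤ) + 0ℤ) ≡ -1ℤ
    e = solve-∀

  -- From the degree of (1 - x^M)^d on, the truncation i ≤ m cuts off nothing of the support of
  -- `δ M d`, so `ν` agrees with `conv`.
  ν-high : ∀ M d A → (∀ n → conv M d A n ≡ 0ℤ) → ∀ k → ν M d A (deg M d + + k) ≡ 0ℤ
  ν-high M d A z k = begin
    ∑ t 0ℤ (D + + k + 1ℤ)                          ≡⟨ ∑-split t 0ℤ (D + 1ℤ) (D + + k + 1ℤ) ⟩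
    ∑ t 0ℤ (D + 1ℤ) + ∑ t (D + 1ℤ) (D + + k + 1ℤ)  ≡⟨ cong₂ _+_ (z (D + + k))
        (trans (cong (∑ t (D + 1ℤ)) (e D (+ k))) (∑-term-high M d A (D + + k) k)) ⟩
    0ℤ                                             ∎
    where
    D = deg M d
    t = term M d A (D + + k)
    e : ∀ D k → D + k + 1ℤ ≡ D + 1ℤ + k
    e = solve-∀

  -- After i ↦ D - i the left side is, up to `sgn d`, the sum of δᵢ A(i - m) over m ≤ i ≤ D. The sum
  -- over 0 ≤ i ≤ D is zero, so this is minus the sum over 0 ≤ i < m, where A has negative
  -- arguments. Those between -s and 0 contribute nothing; the others are reflected to A(m - s - i),
  -- which leaves `ν` at m - s.
  ν-reflect : ∀ M d A s ε → 1ℤ ≤ s → (∀ n → conv M d A n ≡ 0ℤ) →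
              (∀ n → A (- s - n) ≡ ε * A n) → (∀ n → - s + 1ℤ ≤ n → n + 1ℤ ≤ 0ℤ → A n ≡ 0ℤ) →
              ∀ m → ν M d A (deg M d - m) ≡ - (ε * sgn d) * ν M d A (m - s)
  ν-reflect M d A s ε 1≤s ann refl-A van m = begin
    ∑ h 0ℤ (D - m + 1ℤ)                      ≡⟨ cong₂ (∑ h) (e₁ D) (e₂ D m) ⟩
    ∑ h (D + 1ℤ - (D + 1ℤ)) (D + 1ℤ - m)     ≡⟨ ∑-reflect h D m (D + 1ℤ) ⟨
    ∑ (λ i → h (D - i)) m (D + 1ℤ)           ≡⟨ ∑-cong flip m (D + 1ℤ) ⟩
    ∑ k m (D + 1ℤ)                           ≡⟨ e₃ (∑ k m (D + 1ℤ)) (∑ k 0ℤ m) ⟩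
    ∑ k 0ℤ m + ∑ k m (D + 1ℤ) - ∑ k 0ℤ m     ≡⟨ cong (_- ∑ k 0ℤ m) (∑-split k 0ℤ m (D + 1ℤ)) ⟨
    ∑ k 0ℤ (D + 1ℤ) - ∑ k 0ℤ m               ≡⟨ cong (_- ∑ k 0ℤ m) total ⟩
    0ℤ - ∑ k 0ℤ m                            ≡⟨ cong (λ z → 0ℤ - z) (∑-split k 0ℤ b m) ⟩
    0ℤ - (∑ k 0ℤ b + ∑ k b m)                ≡⟨ cong (λ z → 0ℤ - (∑ k 0ℤ b + z)) gap ⟩
    0ℤ - (∑ k 0ℤ b + 0ℤ)                     ≡⟨ cong (λ z → 0ℤ - (z + 0ℤ)) (trans (∑-cong back 0ℤ b) (∑-* (sgn d * ε) (term M d A (m - s)) 0ℤ b)) ⟩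
    0ℤ - (sgn d * ε * ν M d A (m - s) + 0ℤ)  ≡⟨ e₄ (sgn d) ε (ν M d A (m - s)) ⟩
    - (ε * sgn d) * ν M d A (m - s)          ∎
    where
    D = deg M d
    b = m - s + 1ℤ
    h k : ℤ → ℤ
    h = term M d A (D - m)
    k i = sgn d * (δ M d i * A (i - m))
    e₁ : ∀ D → 0ℤ ≡ D + 1ℤ - (D + 1ℤ)
    e₁ = solve-∀
    e₂ : ∀ D m → D - m + 1ℤ ≡ D + 1ℤ - m
    e₂ = solve-∀
    e₃ : ∀ x y → x ≡ y + x - y
    e₃ = solve-∀
    e₄ : ∀ s ε x → 0ℤ - (s * ε * x + 0ℤ) ≡ - (ε * s) * x
    e₄ = solve-∀
    e₅ : ∀ D m i → D - m - (D - i) ≡ i - m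
    e₅ = solve-∀
    e₆ : ∀ i m s → i - m ≡ - s - (m - s - i)
    e₆ = solve-∀
    e₇ : ∀ s x ε a → s * (x * (ε * a)) ≡ s * ε * (x * a)
    e₇ = solve-∀
    e₈ : ∀ m s i → i - m - (- s + 1ℤ) ≡ i - (m - s + 1ℤ)
    e₈ = solve-∀
    e₉ : ∀ m i → 0ℤ - (i - m + 1ℤ) ≡ m - (i + 1ℤ)
    e₉ = solve-∀
    e₁₀ : ∀ m s i → i + (m - s + 1ℤ) + s - (m + (i + 1ℤ) + 1ℤ) ≡ -1ℤ
    e₁₀ = solve-∀
    flip : ∀ i → h (D - i) ≡ k i
    flip i = trans (cong₂ _*_ (δ-reflect M d i) (cong A (e₅ D m i))) (ℤ.*-assoc (sgn d) (δ M d i) (A (i - m)))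
    total : ∑ k 0ℤ (D + 1ℤ) ≡ 0ℤ
    total = begin
      ∑ k 0ℤ (D + 1ℤ)                          ≡⟨ ∑-cong flip 0ℤ (D + 1ℤ) ⟨
      ∑ (λ i → h (D - i)) 0ℤ (D + 1ℤ)          ≡⟨ ∑-reflect h D 0ℤ (D + 1ℤ) ⟩
      ∑ h (D + 1ℤ - (D + 1ℤ)) (D + 1ℤ - 0ℤ)    ≡⟨ cong₂ (∑ h) (e₁ D) (sym (ℤ.+-identityʳ (D + 1ℤ))) ⟨
      ∑ h 0ℤ (D + 1ℤ)                          ≡⟨ ann (D - m) ⟩
      0ℤ                                       ∎
    gap : ∑ k b m ≡ 0ℤ
    gap = ∑-vanish k b m
      (λ i lo hi → trans (cong (λ z → sgn d * (δ M d i * z)) (van (i - m) (≤-from _ _ lo (e₈ m s i)) (≤-from _ _ hi (e₉ m i))))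
                         (trans (cong (sgn d *_) (ℤ.*-zeroʳ (δ M d i))) (ℤ.*-zeroʳ (sgn d))))
      (λ i lo hi → ⊥-elim (≤-absurd 0 (ℤ.+-mono-≤ (ℤ.+-mono-≤ lo hi) 1≤s) (e₁₀ m s i)))
    back : ∀ i → k i ≡ sgn d * ε * term M d A (m - s) i
    back i = trans (cong (λ z → sgn d * (δ M d i * z)) (trans (cong A (e₆ i m s)) (refl-A (m - s - i))))
                   (e₇ (sgn d) (δ M d i) ε (A (m - s - i)))

  foldr-∑ : ∀ (g : ℕ → ℤ) G a n → (∀ i → i ℕ.< n → g i ≡ G (a + + i)) →
            foldr _+_ 0ℤ (applyUpTo g n) ≡ ∑ G a (a + + n)
  foldr-∑ g G a zero    e = sym (trans (cong (∑ G a) (ℤ.+-identityʳ a)) (∑-empty G a))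
  foldr-∑ g G a (suc n) e = begin
    g 0 + foldr _+_ 0ℤ (applyUpTo (λ i → g (suc i)) n)
      ≡⟨ cong₂ _+_ (trans (e 0 (s≤s z≤n)) (cong G (ℤ.+-identityʳ a)))
                   (foldr-∑ (λ i → g (suc i)) G (a + 1ℤ) n (λ i i<n → trans (e (suc i) (s≤s i<n)) (cong G (assoc (+ i))))) ⟩
    G a + ∑ G (a + 1ℤ) (a + 1ℤ + + n)
      ≡⟨ cong₂ _+_ (sym first) (cong (∑ G (a + 1ℤ)) (sym (assoc (+ n)))) ⟩
    ∑ G a (a + 1ℤ) + ∑ G (a + 1ℤ) (a + + suc n)     ≡⟨ ∑-split G a (a + 1ℤ) (a + + suc n) ⟨
    ∑ G a (a + + suc n)                             ∎
    where
    assoc : ∀ i → a + (1ℤ + i) ≡ a + 1ℤ + i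
    assoc i = sym (ℤ.+-assoc a 1ℤ i)
    first : ∑ G a (a + 1ℤ) ≡ G a
    first = trans (∑-suc G a a) (trans (cong (_+ G a) (∑-empty G a)) (ℤ.+-identityˡ (G a)))

open Convolution

-- Polynomials in x and 1/x

module RationalFunctions where
  open import Data.Integer.Base using (_+_; _*_; _≤_)

  -- The commutative monoid of polynomials under multiplication

  delay : Series → Series
  delay s zero    = 0ℤ
  delay s (suc n) = s n

  coeff-0∷ : ∀ p n → coeff (0ℤ ∷ p) n ≡ delay (coeff p) n
  coeff-0∷ p zero    = refl
  coeff-0∷ p (suc n) = refl

  delay-cong : ∀ {s t} → s ≗ t → delay s ≗ delay t
  delay-cong e zero    = refl
  delay-cong e (suc n) = e n

  delay-+ : ∀ s t n → delay (λ m → s m + t m) n ≡ delay s n + delay t n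
  delay-+ s t zero    = refl
  delay-+ s t (suc n) = refl

  delay-* : ∀ a s n → delay (λ m → a * s m) n ≡ a * delay s n
  delay-* a s zero    = sym (ℤ.*-zeroʳ a)
  delay-* a s (suc n) = refl

  coeff-∷* : ∀ a p q n → coeff ((a ∷ p) *ₚ q) n ≡ a * coeff q n + delay (coeff (p *ₚ q)) n
  coeff-∷* a p q n = trans (coeff-∷-*ₚ a p q n) (cong (λ z → a * coeff q n + z) (coeff-0∷ (p *ₚ q) n))

  coeff-*∷ : ∀ p b q n → coeff (p *ₚ (b ∷ q)) n ≡ b * coeff p n + delay (coeff (p *ₚ q)) n
  coeff-*∷ []      b q zero    = sym (trans (ℤ.+-identityʳ _) (ℤ.*-zeroʳ b))
  coeff-*∷ []      b q (suc n) = sym (trans (ℤ.+-identityʳ _) (ℤ.*-zeroʳ b))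
  coeff-*∷ (a ∷ p) b q zero    = trans (coeff-∷* a p (b ∷ q) 0) (cong (_+ 0ℤ) (ℤ.*-comm a b))
  coeff-*∷ (a ∷ p) b q (suc n) = begin
    coeff ((a ∷ p) *ₚ (b ∷ q)) (suc n)                            ≡⟨ coeff-∷* a p (b ∷ q) (suc n) ⟩
    a * coeff q n + coeff (p *ₚ (b ∷ q)) n                        ≡⟨ cong (λ z → a * coeff q n + z) (coeff-*∷ p b q n) ⟩
    a * coeff q n + (b * coeff p n + delay (coeff (p *ₚ q)) n)    ≡⟨ e (a * coeff q n) (b * coeff p n) _ ⟩
    b * coeff p n + (a * coeff q n + delay (coeff (p *ₚ q)) n)    ≡⟨ cong (λ z → b * coeff p n + z) (coeff-∷* a p q n) ⟨
    b * coeff p n + coeff ((a ∷ p) *ₚ q) n                        ∎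
    where
    e : ∀ x y z → x + (y + z) ≡ y + (x + z)
    e = solve-∀

  *ₚ-zeroʳ : ∀ p → p *ₚ [] ≈ₚ []
  *ₚ-zeroʳ []      n       = refl
  *ₚ-zeroʳ (a ∷ p) n = trans (coeff-∷* a p [] n) (trans (cong₂ _+_ (ℤ.*-zeroʳ a) (delay-cong (*ₚ-zeroʳ p) n)) (delay-zero n))
    where
    delay-zero : ∀ n → 0ℤ + delay (λ _ → 0ℤ) n ≡ 0ℤ
    delay-zero zero    = refl
    delay-zero (suc n) = refl

  *ₚ-comm : ∀ p q → p *ₚ q ≈ₚ q *ₚ p
  *ₚ-comm []      q n = sym (*ₚ-zeroʳ q n)
  *ₚ-comm (a ∷ p) q n = trans (coeff-∷* a p q n)
    (trans (cong (λ z → a * coeff q n + z) (delay-cong (*ₚ-comm p q) n)) (sym (coeff-*∷ q a p n)))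

  *ₚ-congˡ : ∀ p {q q′} → q ≈ₚ q′ → p *ₚ q ≈ₚ p *ₚ q′
  *ₚ-congˡ []      e n = refl
  *ₚ-congˡ (a ∷ p) {q} {q′} e n = trans (coeff-∷* a p q n)
    (trans (cong₂ (λ y z → a * y + z) (e n) (delay-cong (*ₚ-congˡ p e) n)) (sym (coeff-∷* a p q′ n)))

  *ₚ-cong : ∀ {p p′ q q′} → p ≈ₚ p′ → q ≈ₚ q′ → p *ₚ q ≈ₚ p′ *ₚ q′
  *ₚ-cong {p} {p′} {q} {q′} e e′ n = trans (*ₚ-congˡ p e′ n)
    (trans (*ₚ-comm p q′ n) (trans (*ₚ-congˡ q′ e n) (*ₚ-comm q′ p′ n)))

  *ₚ-distribʳ : ∀ p q r → (p +ₚ q) *ₚ r ≈ₚ (p *ₚ r) +ₚ (q *ₚ r)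
  *ₚ-distribʳ []      q       r n = refl
  *ₚ-distribʳ (a ∷ p) []      r n = sym (trans (coeff-+ₚ ((a ∷ p) *ₚ r) [] n) (ℤ.+-identityʳ _))
  *ₚ-distribʳ (a ∷ p) (b ∷ q) r n = begin
    coeff ((a + b ∷ (p +ₚ q)) *ₚ r) n                                  ≡⟨ coeff-∷* (a + b) (p +ₚ q) r n ⟩
    (a + b) * coeff r n + delay (coeff ((p +ₚ q) *ₚ r)) n              ≡⟨ cong (λ z → (a + b) * coeff r n + z)
        (trans (delay-cong (λ m → trans (*ₚ-distribʳ p q r m) (coeff-+ₚ (p *ₚ r) (q *ₚ r) m)) n) (delay-+ _ _ n)) ⟩
    (a + b) * coeff r n + (delay (coeff (p *ₚ r)) n + delay (coeff (q *ₚ r)) n)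
                                                                       ≡⟨ e a b (coeff r n) _ _ ⟩
    (a * coeff r n + delay (coeff (p *ₚ r)) n) + (b * coeff r n + delay (coeff (q *ₚ r)) n)
                                                                       ≡⟨ cong₂ _+_ (coeff-∷* a p r n) (coeff-∷* b q r n) ⟨
    coeff ((a ∷ p) *ₚ r) n + coeff ((b ∷ q) *ₚ r) n                    ≡⟨ coeff-+ₚ ((a ∷ p) *ₚ r) ((b ∷ q) *ₚ r) n ⟨
    coeff (((a ∷ p) *ₚ r) +ₚ ((b ∷ q) *ₚ r)) n                         ∎
    where
    e : ∀ a b r x y → (a + b) * r + (x + y) ≡ (a * r + x) + (b * r + y)
    e = solve-∀

  *ₚ-scaleˡ : ∀ a p q n → coeff (map (a *_) p *ₚ q) n ≡ a * coeff (p *ₚ q) n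
  *ₚ-scaleˡ a []      q n = sym (ℤ.*-zeroʳ a)
  *ₚ-scaleˡ a (b ∷ p) q n = begin
    coeff ((a * b ∷ map (a *_) p) *ₚ q) n                       ≡⟨ coeff-∷* (a * b) (map (a *_) p) q n ⟩
    a * b * coeff q n + delay (coeff (map (a *_) p *ₚ q)) n     ≡⟨ cong (λ z → a * b * coeff q n + z)
        (trans (delay-cong (*ₚ-scaleˡ a p q) n) (delay-* a (coeff (p *ₚ q)) n)) ⟩
    a * b * coeff q n + a * delay (coeff (p *ₚ q)) n            ≡⟨ e a b (coeff q n) _ ⟩
    a * (b * coeff q n + delay (coeff (p *ₚ q)) n)              ≡⟨ cong (a *_) (coeff-∷* b p q n) ⟨
    a * coeff ((b ∷ p) *ₚ q) n                                  ∎
    where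
    e : ∀ a b x y → a * b * x + a * y ≡ a * (b * x + y)
    e = solve-∀

  *ₚ-assoc : ∀ p q r → (p *ₚ q) *ₚ r ≈ₚ p *ₚ (q *ₚ r)
  *ₚ-assoc []      q r n = refl
  *ₚ-assoc (a ∷ p) q r n = begin
    coeff ((map (a *_) q +ₚ (0ℤ ∷ p *ₚ q)) *ₚ r) n                     ≡⟨ *ₚ-distribʳ (map (a *_) q) (0ℤ ∷ p *ₚ q) r n ⟩
    coeff ((map (a *_) q *ₚ r) +ₚ ((0ℤ ∷ p *ₚ q) *ₚ r)) n              ≡⟨ coeff-+ₚ (map (a *_) q *ₚ r) _ n ⟩
    coeff (map (a *_) q *ₚ r) n + coeff ((0ℤ ∷ p *ₚ q) *ₚ r) n         ≡⟨ cong₂ _+_ (*ₚ-scaleˡ a q r n)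
        (trans (coeff-∷* 0ℤ (p *ₚ q) r n) (trans (ℤ.+-identityˡ _) (delay-cong (*ₚ-assoc p q r) n))) ⟩
    a * coeff (q *ₚ r) n + delay (coeff (p *ₚ (q *ₚ r))) n             ≡⟨ coeff-∷* a p (q *ₚ r) n ⟨
    coeff ((a ∷ p) *ₚ (q *ₚ r)) n                                      ∎

  [_]ₚ : ℤ → Poly
  [ a ]ₚ = a ∷ []

  coeff-[]* : ∀ a q n → coeff ([ a ]ₚ *ₚ q) n ≡ a * coeff q n
  coeff-[]* a q n = trans (coeff-∷* a [] q n) (trans (cong (λ z → a * coeff q n + z) (zero′ n)) (ℤ.+-identityʳ _))
    where
    zero′ : ∀ n → delay (coeff []) n ≡ 0ℤ
    zero′ zero    = refl
    zero′ (suc n) = refl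

  *ₚ-identityˡ : ∀ p → [ 1ℤ ]ₚ *ₚ p ≈ₚ p
  *ₚ-identityˡ p n = trans (coeff-[]* 1ℤ p n) (ℤ.*-identityˡ _)

  *ₚ-identityʳ : ∀ p → p *ₚ [ 1ℤ ]ₚ ≈ₚ p
  *ₚ-identityʳ p n = trans (*ₚ-comm p [ 1ℤ ]ₚ n) (*ₚ-identityˡ p n)

  *ₚ-commutativeMonoid : CommutativeMonoid _ _
  *ₚ-commutativeMonoid = record
    { Carrier = Poly ; _≈_ = _≈ₚ_ ; _∙_ = _*ₚ_ ; ε = [ 1ℤ ]ₚ
    ; isCommutativeMonoid = record
      { isMonoid = record
        { isSemigroup = record
          { isMagma = record
            { isEquivalence = record
              { refl = λ _ → refl ; sym = λ e n → sym (e n) ; trans = λ e e′ n → trans (e n) (e′ n) }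
            ; ∙-cong = λ {p} {p′} {q} {q′} → *ₚ-cong {p} {p′} {q} {q′} }
          ; assoc = *ₚ-assoc }
        ; identity = *ₚ-identityˡ , *ₚ-identityʳ }
      ; comm = *ₚ-comm } }

  module _ {c ℓ : Level} (M : CommutativeMonoid c ℓ) where
    open CommutativeMonoid M using (Carrier; _≈_; _∙_; ε; setoid; ∙-cong; ∙-congˡ; ∙-congʳ) renaming (refl to ≈-refl)
    open import Algebra.Solver.CommutativeMonoid M using (_⊜_; _⊕_; id) renaming (solve to solveₘ)
    open import Relation.Binary.Reasoning.Setoid setoid as ≈

    -- The equation n / d = ε′ x⁻ˢ (n̄ / e) / (d̄ / e) with denominators cleared, where n̄ / e and
    -- d̄ / e are the values of n and d at 1/x. Signs enter as constant polynomials, so everything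
    -- is multiplicative and within reach of the monoid solver.
    cross-multiplied : ∀ n d e x xˢ 1ˢ σ η ε′ n̄ d̄ → 1ˢ ≈ ε → d̄ ≈ σ ∙ (x ∙ d) → n̄ ≈ η ∙ (x ∙ (xˢ ∙ n)) → ε′ ∙ η ≈ σ →
                       n ∙ ((ε ∙ xˢ) ∙ (e ∙ d̄)) ≈ ((ε′ ∙ 1ˢ) ∙ (n̄ ∙ e)) ∙ d
    cross-multiplied n d e x xˢ 1ˢ σ η ε′ n̄ d̄ p q r t = ≈.begin
      n ∙ ((ε ∙ xˢ) ∙ (e ∙ d̄))
        ≈.≈⟨ ∙-congˡ (∙-congˡ (∙-congˡ q)) ⟩
      n ∙ ((ε ∙ xˢ) ∙ (e ∙ (σ ∙ (x ∙ d))))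
        ≈.≈⟨ solveₘ 6 (λ n xˢ e σ x d → n ⊕ ((id ⊕ xˢ) ⊕ (e ⊕ (σ ⊕ (x ⊕ d)))) ⊜ (σ ⊕ ((x ⊕ (xˢ ⊕ n)) ⊕ e)) ⊕ d)
               ≈-refl n xˢ e σ x d ⟩
      (σ ∙ ((x ∙ (xˢ ∙ n)) ∙ e)) ∙ d
        ≈.≈⟨ ∙-congʳ (∙-congʳ t) ⟨
      ((ε′ ∙ η) ∙ ((x ∙ (xˢ ∙ n)) ∙ e)) ∙ d
        ≈.≈⟨ solveₘ 5 (λ ε′ η v e d → ((ε′ ⊕ η) ⊕ (v ⊕ e)) ⊕ d ⊜ ((ε′ ⊕ id) ⊕ ((η ⊕ v) ⊕ e)) ⊕ d)
               ≈-refl ε′ η (x ∙ (xˢ ∙ n)) e d ⟩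
      ((ε′ ∙ ε) ∙ ((η ∙ (x ∙ (xˢ ∙ n))) ∙ e)) ∙ d
        ≈.≈⟨ ∙-congʳ (∙-cong (∙-congˡ p) (∙-congʳ r)) ⟨
      ((ε′ ∙ 1ˢ) ∙ (n̄ ∙ e)) ∙ d ≈.∎

  X : Poly
  X = 0ℤ ∷ 1ℤ ∷ []

  -- p ∼ φ: the coefficients of p, extended by 0 to negative exponents, are φ.
  record _∼_ (p : Poly) (φ : ℤ → ℤ) : Set where
    constructor _,_
    field
      at-pos : ∀ n → coeff p n ≡ φ (+ n)
      at-neg : ∀ n → φ -[1+ n ] ≡ 0ℤ
  open _∼_

  ∼-cong : ∀ {p φ ψ} → p ∼ φ → φ ≗ ψ → p ∼ ψ
  ∼-cong (a , b) e = (λ n → trans (a n) (e (+ n))) , (λ n → trans (sym (e -[1+ n ])) (b n))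

  ∼-resp : ∀ {p q φ} → q ≈ₚ p → p ∼ φ → q ∼ φ
  ∼-resp e (a , b) = (λ n → trans (e n) (a n)) , b

  ∼-scale : ∀ {p φ} a → p ∼ φ → ([ a ]ₚ *ₚ p) ∼ (λ z → a * φ z)
  ∼-scale {p} a (r , s) = (λ n → trans (coeff-[]* a p n) (cong (a *_) (r n)))
                        , (λ n → trans (cong (a *_) (s n)) (ℤ.*-zeroʳ a))

  ∼-X : ∀ {p φ} → p ∼ φ → (X *ₚ p) ∼ (λ z → φ (z - 1ℤ))
  ∼-X {p} {φ} (r , s) = pos , (λ n → trans (cong (λ m → φ -[1+ suc m ]) (ℕ.+-identityʳ n)) (s (suc n)))
    where
    pos : ∀ n → coeff (X *ₚ p) n ≡ φ (+ n - 1ℤ)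
    pos zero    = trans (coeff-∷* 0ℤ [ 1ℤ ]ₚ p 0) (sym (s 0))
    pos (suc n) = trans (coeff-∷* 0ℤ [ 1ℤ ]ₚ p (suc n)) (trans (ℤ.+-identityˡ _) (trans (*ₚ-identityˡ p n) (r n)))

  ∼-x⁻¹^ : ∀ {p φ} s → p ∼ φ → (den (x⁻¹ ^ᵣ s) *ₚ p) ∼ (λ z → φ (z - + s))
  ∼-x⁻¹^ {p} {φ} zero    r = ∼-cong (∼-resp (*ₚ-identityˡ p) r) (λ z → cong φ (sym (ℤ.+-identityʳ z)))
  ∼-x⁻¹^ {p} {φ} (suc s) r = ∼-resp (*ₚ-assoc X (den (x⁻¹ ^ᵣ s)) p)
    (∼-cong (∼-X (∼-x⁻¹^ s r)) (λ z → cong φ (e z (+ s))))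
    where
    e : ∀ z s → z - 1ℤ - s ≡ z - (1ℤ + s)
    e = solve-∀

  num-x⁻¹^ : ∀ s → num (x⁻¹ ^ᵣ s) ≈ₚ [ 1ℤ ]ₚ
  num-x⁻¹^ zero    n = refl
  num-x⁻¹^ (suc s) n = trans (*ₚ-identityˡ (num (x⁻¹ ^ᵣ s)) n) (num-x⁻¹^ s n)

  -- Values of polynomials at 1/x

  unitAt : ℤ → ℤ
  unitAt = δ 0 0

  extend : Poly → ℤ → ℤ
  extend p (+ n)    = coeff p n
  extend p -[1+ _ ] = 0ℤ

  -- As `unitAt` is the Kronecker delta, this denominator is x to the power `length p`: Horner's
  -- rule contributes a factor x per coefficient, trailing zeros included, and cancels nothing.
  den-at : ∀ p → den (p at x⁻¹) ∼ (λ z → unitAt (+ length p - z))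
  den-at []      = (λ { zero → refl ; (suc n) → refl }) , (λ n → refl)
  den-at (a ∷ p) = ∼-cong (∼-scale 1ℤ (∼-X (den-at p)))
    (λ z → trans (ℤ.*-identityˡ _) (cong unitAt (e (+ length p) z)))
    where
    e : ∀ l z → l - (z - 1ℤ) ≡ 1ℤ + l - z
    e = solve-∀

  den-at-length : ∀ p q → length p ≡ length q → den (p at x⁻¹) ≡ den (q at x⁻¹)
  den-at-length []      []      _ = refl
  den-at-length (a ∷ p) (b ∷ q) e =
    cong (λ d → [ 1ℤ ]ₚ *ₚ (X *ₚ d)) (den-at-length p q (ℕ.suc-injective e))

  extend-∷ : ∀ a p z → extend (a ∷ p) z ≡ a * unitAt z + extend p (z - 1ℤ)
  extend-∷ a p (+ zero)  = sym (trans (ℤ.+-identityʳ _) (ℤ.*-identityʳ a))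
  extend-∷ a p (+ suc n) = sym (trans (cong (_+ coeff p n) (ℤ.*-zeroʳ a)) (ℤ.+-identityˡ _))
  extend-∷ a p -[1+ n ]  = sym (cong (_+ 0ℤ) (ℤ.*-zeroʳ a))

  -- Over the denominator x to the `length p`, the numerator lists the coefficients of p backwards.
  -- Since a list of degree m has at least m + 1 entries, a factor x is left over.
  num-at : ∀ p n → coeff (num (p at x⁻¹)) n ≡ extend p (+ length p - + n)
  num-at []      zero    = refl
  num-at []      (suc n) = refl
  num-at (a ∷ p) n = begin
    coeff (([ a ]ₚ *ₚ (X *ₚ E)) +ₚ (([ 1ℤ ]ₚ *ₚ V) *ₚ [ 1ℤ ]ₚ)) n
      ≡⟨ coeff-+ₚ ([ a ]ₚ *ₚ (X *ₚ E)) _ n ⟩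
    coeff ([ a ]ₚ *ₚ (X *ₚ E)) n + coeff (([ 1ℤ ]ₚ *ₚ V) *ₚ [ 1ℤ ]ₚ) n
      ≡⟨ cong₂ _+_ (at-pos (∼-scale a (∼-X (den-at p))) n)
                   (trans (*ₚ-identityʳ ([ 1ℤ ]ₚ *ₚ V) n) (trans (*ₚ-identityˡ V n) (num-at p n))) ⟩
    a * unitAt (+ length p - (+ n - 1ℤ)) + extend p (+ length p - + n)
      ≡⟨ cong₂ (λ y z → a * unitAt y + extend p z) (e (+ length p) (+ n)) (e′ (+ length p) (+ n)) ⟩
    a * unitAt (1ℤ + + length p - + n) + extend p (1ℤ + + length p - + n - 1ℤ)
      ≡⟨ extend-∷ a p (1ℤ + + length p - + n) ⟨
    extend (a ∷ p) (1ℤ + + length p - + n) ∎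
    where
    E = den (p at x⁻¹)
    V = num (p at x⁻¹)
    e : ∀ l z → l - (z - 1ℤ) ≡ 1ℤ + l - z
    e = solve-∀
    e′ : ∀ l z → l - z ≡ 1ℤ + l - z - 1ℤ
    e′ = solve-∀

  coeff-applyUpTo : ∀ (g : ℕ → ℤ) n → (∀ i → n ℕ.≤ i → g i ≡ 0ℤ) → coeff (applyUpTo g n) ≗ g
  coeff-applyUpTo g zero    z i       = sym (z i z≤n)
  coeff-applyUpTo g (suc n) z zero    = refl
  coeff-applyUpTo g (suc n) z (suc i) = coeff-applyUpTo (λ i → g (suc i)) n (λ i p → z (suc i) (s≤s p)) i

  ∼⇒extend : ∀ {p φ} → p ∼ φ → ∀ z → extend p z ≡ φ z
  ∼⇒extend r (+ n)    = at-pos r n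
  ∼⇒extend r -[1+ n ] = sym (at-neg r n)

  sgn-square : ∀ n → sgn n * sgn n ≡ 1ℤ
  sgn-square zero    = refl
  sgn-square (suc n) = trans (e (sgn n)) (sgn-square n)
    where
    e : ∀ x → -1ℤ * x * (-1ℤ * x) ≡ x * x
    e = solve-∀

  period-nonZero : ∀ j → ℕ.NonZero (period 1 j)
  period-nonZero zero    = _
  period-nonZero (suc j) = ℕ.m*n≢0 (suc (suc j)) (period 1 j) {{_}} {{period-nonZero j}}

  triangle : ℕ → ℕ
  triangle zero    = 1
  triangle (suc j) = triangle j ℕ.+ suc (suc j)

  τ≡triangle : ∀ j → τ j ≡ + triangle j
  τ≡triangle zero    = refl
  τ≡triangle (suc j) = cong (_+ + suc (suc j)) (τ≡triangle j)

  triangle*2 : ∀ j → triangle j ℕ.* 2 ≡ suc j ℕ.* suc (suc j)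
  triangle*2 zero    = refl
  triangle*2 (suc j) = trans (ℕ.*-distribʳ-+ 2 (triangle j) (suc (suc j)))
    (trans (cong (ℕ._+ suc (suc j) ℕ.* 2) (triangle*2 j)) (e j))
    where
    e : ∀ j → suc j ℕ.* suc (suc j) ℕ.+ suc (suc j) ℕ.* 2 ≡ suc (suc j) ℕ.* suc (suc (suc j))
    e = ℕsolve-∀

  -- The division is exact: with r = j + 1 and k = K + 1, r (r - 1 + 2 k) = r (r + 1) + 2 K r, and r
  -- (r + 1) is twice a triangular number.
  exponent : ∀ K j → + (suc j ℕ.* (j ℕ.+ 2 ℕ.* suc K) ℕ./ 2) ≡ shift K j
  exponent K j = begin
    + (suc j ℕ.* (j ℕ.+ 2 ℕ.* suc K) ℕ./ 2)            ≡⟨ cong (λ m → + (m ℕ./ 2)) (e j K) ⟩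
    + ((suc j ℕ.* suc (suc j) ℕ.+ K ℕ.* suc j ℕ.* 2) ℕ./ 2)
      ≡⟨ cong (λ m → + ((m ℕ.+ K ℕ.* suc j ℕ.* 2) ℕ./ 2)) (triangle*2 j) ⟨
    + ((triangle j ℕ.* 2 ℕ.+ K ℕ.* suc j ℕ.* 2) ℕ./ 2) ≡⟨ cong (λ m → + (m ℕ./ 2)) (ℕ.*-distribʳ-+ 2 (triangle j) (K ℕ.* suc j)) ⟨
    + ((triangle j ℕ.+ K ℕ.* suc j) ℕ.* 2 ℕ./ 2)       ≡⟨ cong +_ (m*n/n≡m (triangle j ℕ.+ K ℕ.* suc j) 2) ⟩
    + triangle j + + (K ℕ.* suc j)                     ≡⟨ cong₂ _+_ (sym (τ≡triangle j)) (ℤ.pos-* K (suc j)) ⟩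
    τ j + + K * + suc j                                ∎
    where
    e : ∀ j K → suc j ℕ.* (j ℕ.+ 2 ℕ.* suc K) ≡ suc j ℕ.* suc (suc j) ℕ.+ K ℕ.* suc j ℕ.* 2
    e = ℕsolve-∀

  1≤shift : ∀ K j → 1ℤ ≤ shift K j
  1≤shift K j = ℤ.≤-trans (1≤τ j)
    (subst (λ z → τ j ≤ τ j + z) (ℤ.pos-* K (suc j)) (ℤ.i≤i+j (τ j) (+ (K ℕ.* suc j))))

  -- The functional equation

  module _ (K j : ℕ) (α≡A : ∀ n → + α (suc K) (suc j) n ≡ A K j (+ n)) where

    private
      M d s e L : ℕ
      M = period 1 j
      d = proj₁ (qp-A K j)
      s = suc j ℕ.* (j ℕ.+ 2 ℕ.* suc K) ℕ./ 2
      e = j ℕ.+ K ℕ.* suc j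
      -- Room for the degree of `D`. The degree of `N` is smaller, but with equal lengths both
      -- denominators at 1/x are the same power of x and cancel.
      L = suc (d ℕ.* M)
      ann : ∀ n → conv M d (A K j) n ≡ 0ℤ
      ann = conv-quasiPoly M d (proj₂ (qp-A K j))
      numer : ℤ → ℤ
      numer = ν M d (A K j)
      D N : Poly
      D = applyUpTo (λ i → δ M d (+ i)) L
      N = applyUpTo (λ i → numer (+ i)) L

      D∼ : D ∼ δ M d
      D∼ = coeff-applyUpTo _ _ (λ i p → δ-high M d (+ i) (subst (_≤ + i) (ℤ.+-comm 1ℤ (deg M d)) (+≤+ p)))
         , (λ n → δ-low M d -[1+ n ] (ℤ.+-monoˡ-≤ 1ℤ (ℤ.-≤- (z≤n {n}))))

      N∼ : N ∼ numer
      N∼ = coeff-applyUpTo _ _ (λ i p → trans (cong (λ k → numer (+ k)) (sym (ℕ.m+[n∸m]≡n (ℕ.<⇒≤ p))))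
                                              (ν-high M d (A K j) ann (i ℕ.∸ d ℕ.* M)))
         , (λ n → ν-low M d (A K j) -[1+ n ] (ℤ.+-monoˡ-≤ 1ℤ (ℤ.-≤- (z≤n {n}))))

      D-nonzero : Nonzero D
      D-nonzero = 0 , λ p → case trans (sym (δ-zero M d {{period-nonZero j}})) p of λ ()

      F : RatFun
      F = frac N D D-nonzero

      expands : F ExpandsTo (λ n → + α (suc K) (suc j) n)
      expands n = begin
        foldr _+_ 0ℤ (applyUpTo (λ i → coeff D i * + α (suc K) (suc j) (n ℕ.∸ i)) (suc n))
          ≡⟨ foldr-∑ _ (λ i → δ M d i * A K j (+ n - i)) 0ℤ (suc n) (λ i i<n →
               cong₂ _*_ (at-pos D∼ i) (trans (α≡A (n ℕ.∸ i)) (cong (A K j) (sym (trans (ℤ.m-n≡m⊖n n i) (ℤ.⊖-≥ (ℕ.≤-pred i<n))))))) ⟩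
        ∑ (λ i → δ M d i * A K j (+ n - i)) 0ℤ (1ℤ + + n)
          ≡⟨ cong (∑ (λ i → δ M d i * A K j (+ n - i)) 0ℤ) (ℤ.+-comm 1ℤ (+ n)) ⟩
        numer (+ n)
          ≡⟨ at-pos N∼ n ⟨
        coeff N n ∎

      numD : num (D at x⁻¹) ≈ₚ [ sgn d ]ₚ *ₚ (X *ₚ D)
      numD n = begin
        coeff (num (D at x⁻¹)) n               ≡⟨ num-at D n ⟩
        extend D (+ length D - + n)            ≡⟨ ∼⇒extend D∼ (+ length D - + n) ⟩
        δ M d (+ length D - + n)               ≡⟨ cong (λ l → δ M d (+ l - + n)) (List.length-applyUpTo (λ i → δ M d (+ i)) L) ⟩
        δ M d (1ℤ + deg M d - + n)             ≡⟨ cong (δ M d) (swap (deg M d) (+ n)) ⟩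
        δ M d (deg M d - (+ n - 1ℤ))           ≡⟨ δ-reflect M d (+ n - 1ℤ) ⟩
        sgn d * δ M d (+ n - 1ℤ)               ≡⟨ at-pos (∼-scale (sgn d) (∼-X D∼)) n ⟨
        coeff ([ sgn d ]ₚ *ₚ (X *ₚ D)) n       ∎
        where
        swap : ∀ l z → 1ℤ + l - z ≡ l - (z - 1ℤ)
        swap = solve-∀

      η : ℤ
      η = - (sgn e * sgn d)

      numN : num (N at x⁻¹) ≈ₚ [ η ]ₚ *ₚ (X *ₚ (den (x⁻¹ ^ᵣ s) *ₚ N))
      numN n = begin
        coeff (num (N at x⁻¹)) n                     ≡⟨ num-at N n ⟩
        extend N (+ length N - + n)                  ≡⟨ ∼⇒extend N∼ (+ length N - + n) ⟩
        numer (+ length N - + n)                     ≡⟨ cong (λ l → numer (+ l - + n)) (List.length-applyUpTo (λ i → numer (+ i)) L) ⟩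
        numer (1ℤ + deg M d - + n)                   ≡⟨ cong numer (swap (deg M d) (+ n)) ⟩
        numer (deg M d - (+ n - 1ℤ))                 ≡⟨ ν-reflect M d (A K j) (shift K j) (sgn e) (1≤shift K j) ann
                                                          (A-reflect K j) (A-vanish K j) (+ n - 1ℤ) ⟩
        η * numer (+ n - 1ℤ - shift K j)             ≡⟨ cong (λ z → η * numer (+ n - 1ℤ - z)) (exponent K j) ⟨
        η * numer (+ n - 1ℤ - + s)                   ≡⟨ at-pos (∼-scale η (∼-X (∼-x⁻¹^ s N∼))) n ⟨
        coeff ([ η ]ₚ *ₚ (X *ₚ (den (x⁻¹ ^ᵣ s) *ₚ N))) n ∎
        where
        swap : ∀ l z → 1ℤ + l - z ≡ l - (z - 1ℤ)
        swap = solve-∀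

      -- `suc e` is k r. Its additional sign cancels the minus in `η`, and the two factors `sgn e`
      -- cancel each other.
      signs : [ sgn (suc e) ]ₚ *ₚ [ η ]ₚ ≈ₚ [ sgn d ]ₚ
      signs zero    = trans (ℤ.+-identityʳ _) (trans (ring (sgn e) (sgn d))
        (trans (cong (_* sgn d) (sgn-square e)) (ℤ.*-identityˡ _)))
        where
        ring : ∀ x y → -1ℤ * x * - (x * y) ≡ x * x * y
        ring = solve-∀
      signs (suc n) = refl

    functionalEquation : ∃[ F ] (F ExpandsTo (λ n → + α (suc K) (suc j) n)) ×
      (F ≃ const (sgn (suc K ℕ.* suc j)) · x⁻¹ ^ᵣ s · F ⟨1/x⟩)
    functionalEquation = F , expands , λ i → trans
      (cong (λ e → coeff (N *ₚ (([ 1ℤ ]ₚ *ₚ den (x⁻¹ ^ᵣ s)) *ₚ (e *ₚ num (D at x⁻¹)))) i)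
            (den-at-length N D (trans (List.length-applyUpTo (λ i → numer (+ i)) L) (sym (List.length-applyUpTo (λ i → δ M d (+ i)) L)))))
      (cross-multiplied *ₚ-commutativeMonoid N D (den (D at x⁻¹)) X (den (x⁻¹ ^ᵣ s)) (num (x⁻¹ ^ᵣ s))
        [ sgn d ]ₚ [ η ]ₚ [ sgn (suc e) ]ₚ (num (N at x⁻¹)) (num (D at x⁻¹)) (num-x⁻¹^ s) numD numN signs i)

open RationalFunctions

-- Enumeration of the matrices

module Counting where
  open import Data.Integer.Base using (_+_; _*_; _≤_)

  total : ∀ {X : Set} → (X → ℤ) → List X → ℤ
  total φ xs = foldr _+_ 0ℤ (map φ xs)

  total-++ : ∀ {X : Set} (φ : X → ℤ) xs ys → total φ (xs ++ ys) ≡ total φ xs + total φ ys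
  total-++ φ []       ys = sym (ℤ.+-identityˡ _)
  total-++ φ (x ∷ xs) ys = trans (cong (λ z → φ x + z) (total-++ φ xs ys)) (sym (ℤ.+-assoc (φ x) _ _))

  total-map : ∀ {X Y : Set} (φ : Y → ℤ) (h : X → Y) xs → total φ (map h xs) ≡ total (λ x → φ (h x)) xs
  total-map φ h []       = refl
  total-map φ h (x ∷ xs) = cong (λ z → φ (h x) + z) (total-map φ h xs)

  total-cong : ∀ {X : Set} {φ ψ : X → ℤ} xs → (∀ x → x ∈ xs → φ x ≡ ψ x) → total φ xs ≡ total ψ xs
  total-cong []       e = refl
  total-cong (x ∷ xs) e = cong₂ _+_ (e x (here refl)) (total-cong xs (λ y y∈ → e y (there y∈)))

  length-total : ∀ {X : Set} (xs : List X) → + length xs ≡ total (λ _ → 1ℤ) xs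
  length-total []       = refl
  length-total (x ∷ xs) = cong (λ z → 1ℤ + z) (length-total xs)

  prepend : ∀ {X : Set} {n} → List X → (X → List (Vec X n)) → List (Vec X (suc n))
  prepend xs B = concatMap (λ x → map (x ∷_) (B x)) xs

  total-prepend : ∀ {X : Set} {n} (φ : Vec X (suc n) → ℤ) xs (B : X → List (Vec X n)) →
                  total φ (prepend xs B) ≡ total (λ x → total (λ v → φ (x ∷ v)) (B x)) xs
  total-prepend φ []       B = refl
  total-prepend φ (x ∷ xs) B = trans (total-++ φ (map (x ∷_) (B x)) (prepend xs B))
    (cong₂ _+_ (total-map φ (x ∷_) (B x)) (total-prepend φ xs B))

  ∈-prepend⁺ : ∀ {X : Set} {n x} {v : Vec X n} {xs B} → x ∈ xs → v ∈ B x → (x ∷ v) ∈ prepend xs B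
  ∈-prepend⁺ {x = x} {B = B} x∈ v∈ = ∈-concatMap⁺ (λ y → map (y ∷_) (B y)) (lose x∈ (∈-map⁺ (x ∷_) v∈))

  ∈-prepend⁻ : ∀ {X : Set} {n x} {v : Vec X n} xs B → (x ∷ v) ∈ prepend xs B → x ∈ xs × v ∈ B x
  ∈-prepend⁻ xs B p with y , y∈ , q ← find (∈-concatMap⁻ (λ y → map (y ∷_) (B y)) {xs = xs} p)
    with _ , w∈ , refl ← ∈-map⁻ (y ∷_) q = y∈ , w∈

  prepend-unique : ∀ {X : Set} {n} {xs} {B : X → List (Vec X n)} →
                   Unique xs → (∀ x → Unique (B x)) → Unique (prepend xs B)
  prepend-unique                AllPairs.[]        b = AllPairs.[]
  prepend-unique {xs = x ∷ xs} {B} (x∉ AllPairs.∷ u) b =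
    Unique.++⁺ (Unique.map⁺ Vec.∷-injectiveʳ (b x)) (prepend-unique u b) disjoint
    where
    disjoint : ∀ {v} → v ∈ map (x ∷_) (B x) × v ∈ prepend xs B → ⊥
    disjoint (p , q) with _ , _ , refl ← ∈-map⁻ (x ∷_) p =
      ListAll.lookup x∉ (proj₁ (∈-prepend⁻ xs B q)) refl

  -- Intervals, bounded increasing vectors and chains of rows

  range : ℕ → ℕ → List ℕ
  range l u = applyUpTo (l ℕ.+_) (suc u ℕ.∸ l)

  ∈-range⁺ : ∀ {l u m} → l ℕ.≤ m → m ℕ.≤ u → m ∈ range l u
  ∈-range⁺ {l} {u} {m} l≤m m≤u = subst (_∈ range l u) (ℕ.m+[n∸m]≡n l≤m)
    (∈-applyUpTo⁺ (l ℕ.+_) (ℕ.∸-monoˡ-< (s≤s m≤u) l≤m))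

  <∸⇒+< : ∀ l u {i} → i ℕ.< u ℕ.∸ l → l ℕ.+ i ℕ.< u
  <∸⇒+< zero    u       i< = i<
  <∸⇒+< (suc l) (suc u) i< = s≤s (<∸⇒+< l u i<)

  ∈-range⁻ : ∀ {l u m} → m ∈ range l u → l ℕ.≤ m × m ℕ.≤ u
  ∈-range⁻ {l} {u} m∈ with i , i< , refl ← ∈-applyUpTo⁻ (l ℕ.+_) m∈ =
    ℕ.m≤m+n l i , ℕ.≤-pred (<∸⇒+< l (suc u) i<)

  range-unique : ∀ l u → Unique (range l u)
  range-unique l u = Unique.applyUpTo⁺₁ (l ℕ.+_) (suc u ℕ.∸ l) (λ i<j _ e → ℕ.<⇒≢ i<j (ℕ.+-cancelˡ-≡ l _ _ e))

  -- The bound on `l` admits an empty interval but no reversed one, where the list stays empty while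
  -- the signed sum is a negated sum.
  total-range : ∀ φ G l u → l ℕ.≤ suc u → (∀ m → m ∈ range l u → φ m ≡ G (+ m)) →
                total φ (range l u) ≡ ∑ G (+ l) (+ u + 1ℤ)
  total-range φ G l u l≤ e = begin
    foldr _+_ 0ℤ (map φ (range l u))                          ≡⟨ cong (foldr _+_ 0ℤ) (List.map-applyUpTo (l ℕ.+_) φ (suc u ℕ.∸ l)) ⟩
    foldr _+_ 0ℤ (applyUpTo (λ i → φ (l ℕ.+ i)) (suc u ℕ.∸ l)) ≡⟨ foldr-∑ (λ i → φ (l ℕ.+ i)) G (+ l) (suc u ℕ.∸ l)
                                                                  (λ i i< → e (l ℕ.+ i) (∈-applyUpTo⁺ (l ℕ.+_) i<)) ⟩
    ∑ G (+ l) (+ (l ℕ.+ (suc u ℕ.∸ l)))                       ≡⟨ cong (λ z → ∑ G (+ l) (+ z)) (ℕ.m+[n∸m]≡n l≤) ⟩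
    ∑ G (+ l) (1ℤ + + u)                                      ≡⟨ cong (∑ G (+ l)) (ℤ.+-comm 1ℤ (+ u)) ⟩
    ∑ G (+ l) (+ u + 1ℤ)                                      ∎

  Increasing : ∀ {t} → ℕ → Vec ℕ t → Set
  Increasing l []       = ⊤
  Increasing l (x ∷ xs) = l ℕ.≤ x × Increasing x xs

  increasing-weaken : ∀ {t l m} (xs : Vec ℕ t) → l ℕ.≤ m → Increasing m xs → Increasing l xs
  increasing-weaken []       l≤m _       = tt
  increasing-weaken (x ∷ xs) l≤m (p , q) = ℕ.≤-trans l≤m p , q

  below : ∀ {t} → ℕ → Vec ℕ t → List (Vec ℕ t)
  below l []       = [] ∷ []
  below l (x ∷ xs) = prepend (range l x) (λ m → below m xs)

  below-unique : ∀ {t} l (xs : Vec ℕ t) → Unique (below l xs)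
  below-unique l []       = ListAll.[] AllPairs.∷ AllPairs.[]
  below-unique l (x ∷ xs) = prepend-unique (range-unique l x) (λ m → below-unique m xs)

  ∈-below⁺ : ∀ {t l} {v xs : Vec ℕ t} → Increasing l v → Pointwise ℕ._≤_ v xs → v ∈ below l xs
  ∈-below⁺ {v = []}    _       []       = here refl
  ∈-below⁺ {v = _ ∷ _} {x ∷ xs} (p , i) (q ∷ qs) = ∈-prepend⁺ {B = λ m → below m xs} (∈-range⁺ p q) (∈-below⁺ i qs)

  ∈-below⁻ : ∀ {t} l (v xs : Vec ℕ t) → v ∈ below l xs → Increasing l v × Pointwise ℕ._≤_ v xs
  ∈-below⁻ l []      []       _ = tt , []
  ∈-below⁻ l (m ∷ v) (x ∷ xs) p with m∈ , v∈ ← ∈-prepend⁻ (range l x) (λ m → below m xs) p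
    with l≤m , m≤x ← ∈-range⁻ m∈ | i , q ← ∈-below⁻ m v xs v∈ = (l≤m , i) , m≤x ∷ q

  embed : ∀ {t} → Vec ℕ t → Vec ℤ t
  embed = Vec.map (λ n → + n)

  -- Since `xs` increases, an entry m ≤ x is at most the next bound as well, so no interval is
  -- reversed and the signed sums in `T` are ordinary ones.
  total-below : ∀ {t} φ g l (xs : Vec ℕ t) → Increasing l xs → (∀ v → v ∈ below l xs → φ v ≡ g (embed v)) →
                total φ (below l xs) ≡ T (+ l) (embed xs) g
  total-below φ g l []       _       e = trans (ℤ.+-identityʳ (φ [])) (e [] (here refl))
  total-below φ g l (x ∷ xs) (p , i) e = trans (total-prepend φ (range l x) (λ m → below m xs))
    (total-range _ (λ m → T m (embed xs) (λ v → g (m ∷ v))) l x (ℕ.≤-trans p (ℕ.n≤1+n x)) λ m m∈ →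
      total-below (λ v → φ (m ∷ v)) (λ v → g (+ m ∷ v)) m xs (increasing-weaken xs (proj₂ (∈-range⁻ m∈)) i)
        (λ v v∈ → e (m ∷ v) (∈-prepend⁺ {B = λ m → below m xs} m∈ v∈)))

  chains : ∀ {r} K → Vec ℕ r → List (Matrix K r)
  chains zero    v = [] ∷ []
  chains (suc K) v = prepend (below 0 v) (chains K)

  chains-unique : ∀ {r} K (v : Vec ℕ r) → Unique (chains K v)
  chains-unique zero    v = ListAll.[] AllPairs.∷ AllPairs.[]
  chains-unique (suc K) v = prepend-unique (below-unique 0 v) (chains-unique K)

  length-prepend : ∀ {X : Set} {n} xs (B : X → List (Vec X n)) → + length (prepend xs B) ≡ total (λ x → + length (B x)) xs
  length-prepend xs B = trans (length-total (prepend xs B))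
    (trans (total-prepend (λ _ → 1ℤ) xs B) (total-cong xs (λ x _ → sym (length-total (B x)))))

  length-chains : ∀ {r} K (v : Vec ℕ r) → Increasing 0 v → + length (chains K v) ≡ f K (embed v)
  length-chains zero    v i = refl
  length-chains (suc K) v i = trans (length-prepend (below 0 v) (chains K))
    (total-below _ (f K) 0 v i (λ w w∈ → length-chains K w (proj₁ (∈-below⁻ 0 w v w∈))))

  -- The last entry is forced by the sum and not compared with l, so this is the intended list only if
  -- l * suc j ≤ n.
  tops : ℕ → ∀ j → ℕ → List (Vec ℕ (suc j))
  tops l zero    n = (n ∷ []) ∷ []
  tops l (suc j) n = prepend (range l (n ℕ./ suc (suc j))) (λ p → tops p j (n ℕ.∸ p))

  tops-unique : ∀ l j n → Unique (tops l j n)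
  tops-unique l zero    n = ListAll.[] AllPairs.∷ AllPairs.[]
  tops-unique l (suc j) n = prepend-unique (range-unique l _) (λ p → tops-unique p j (n ℕ.∸ p))

  increasing-sum : ∀ {t} l (v : Vec ℕ t) → Increasing l v → l ℕ.* t ℕ.≤ Vec.sum v
  increasing-sum l []      _       = ℕ.≤-reflexive (ℕ.*-zeroʳ l)
  increasing-sum {suc t} l (x ∷ v) (p , i) = subst (ℕ._≤ x ℕ.+ Vec.sum v) (sym (ℕ.*-suc l t))
    (ℕ.+-mono-≤ p (increasing-sum l v (increasing-weaken v p i)))

  ≤-/⇒*≤ₙ : ∀ {p n} d .{{_ : ℕ.NonZero d}} → p ℕ.≤ n ℕ./ d → p ℕ.* d ℕ.≤ n
  ≤-/⇒*≤ₙ {n = n} d p≤ = ℕ.≤-trans (ℕ.*-monoˡ-≤ d p≤) (m/n*n≤m n d)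

  *≤⇒≤-/ₙ : ∀ {p n} d .{{_ : ℕ.NonZero d}} → p ℕ.* d ℕ.≤ n → p ℕ.≤ n ℕ./ d
  *≤⇒≤-/ₙ {p} {n} d le = subst (ℕ._≤ n ℕ./ d) (m*n/n≡m p d) (/-monoˡ-≤ d le)

  -- Passes on the condition under which `tops` is correct to the remaining j + 1 entries.
  remaining : ∀ {p n} j → p ℕ.* suc (suc j) ℕ.≤ n → p ℕ.≤ n × p ℕ.* suc j ℕ.≤ n ℕ.∸ p
  remaining {p} {n} j le = ℕ.≤-trans (ℕ.m≤m*n p (suc (suc j))) le
    , subst (ℕ._≤ n ℕ.∸ p) (trans (cong (ℕ._∸ p) (ℕ.*-suc p (suc j))) (ℕ.m+n∸m≡n p (p ℕ.* suc j))) (ℕ.∸-monoˡ-≤ p le)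

  ∈-tops⁺ : ∀ {l} j {n} (v : Vec ℕ (suc j)) → Increasing l v → Vec.sum v ≡ n → v ∈ tops l j n
  ∈-tops⁺ zero    (x ∷ [])    i        refl = here (cong (_∷ []) (sym (ℕ.+-identityʳ x)))
  ∈-tops⁺ (suc j) (x ∷ v) (p , i) refl = ∈-prepend⁺ {B = λ p → tops p j (x ℕ.+ Vec.sum v ℕ.∸ p)}
    -- The first entry is the smallest, hence at most the mean of all.
    (∈-range⁺ p (*≤⇒≤-/ₙ (suc (suc j)) (increasing-sum x (x ∷ v) (ℕ.≤-refl , i))))
    (∈-tops⁺ j v i (sym (ℕ.m+n∸m≡n x (Vec.sum v))))

  ∈-tops⁻ : ∀ l j n (v : Vec ℕ (suc j)) → l ℕ.* suc j ℕ.≤ n → v ∈ tops l j n → Increasing l v × Vec.sum v ≡ n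
  ∈-tops⁻ l zero    n (x ∷ []) le (here refl) = (subst (ℕ._≤ n) (ℕ.*-identityʳ l) le , tt) , ℕ.+-identityʳ n
  ∈-tops⁻ l (suc j) n (x ∷ v)  le p
    with x∈ , v∈ ← ∈-prepend⁻ (range l (n ℕ./ suc (suc j))) (λ p → tops p j (n ℕ.∸ p)) p
    with l≤x , x≤ ← ∈-range⁻ x∈
    with x≤n , le′ ← remaining {x} {n} j (≤-/⇒*≤ₙ {x} {n} (suc (suc j)) x≤)
    with i , s ← ∈-tops⁻ x j (n ℕ.∸ x) v le′ v∈ = (l≤x , i) , trans (cong (x ℕ.+_) s) (ℕ.m+[n∸m]≡n x≤n)

  total-tops : ∀ j φ g l n → l ℕ.* suc j ℕ.≤ n → (∀ v → v ∈ tops l j n → φ v ≡ g (embed v)) →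
               total φ (tops l j n) ≡ U j (+ l) (+ n) g
  total-tops zero    φ g l n le e = trans (ℤ.+-identityʳ _) (e (n ∷ []) (here refl))
  total-tops (suc j) φ g l n le e = trans (total-prepend φ (range l (n ℕ./ suc (suc j))) (λ p → tops p j (n ℕ.∸ p)))
    (total-range _ (λ p → U j p (+ n - p) (λ v → g (p ∷ v))) l (n ℕ./ suc (suc j))
      (ℕ.≤-trans (*≤⇒≤-/ₙ (suc (suc j)) le) (ℕ.n≤1+n _)) step)
    where
    step : ∀ p → p ∈ range l (n ℕ./ suc (suc j)) →
           total (λ v → φ (p ∷ v)) (tops p j (n ℕ.∸ p)) ≡ U j (+ p) (+ n - + p) (λ v → g (+ p ∷ v))
    step p p∈ with p≤n , le′ ← remaining {p} {n} j (≤-/⇒*≤ₙ {p} {n} (suc (suc j)) (proj₂ (∈-range⁻ {l} p∈))) =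
      trans (total-tops j (λ v → φ (p ∷ v)) (λ v → g (+ p ∷ v)) p (n ℕ.∸ p) le′
              (λ v v∈ → e (p ∷ v) (∈-prepend⁺ {B = λ p → tops p j (n ℕ.∸ p)} p∈ v∈)))
            (cong (λ z → U j (+ p) z (λ v → g (+ p ∷ v))) (sym (trans (ℤ.m-n≡m⊖n n p) (ℤ.⊖-≥ p≤n))))

  reversedMatrices : ∀ K j → ℕ → List (Matrix (suc K) (suc j))
  reversedMatrices K j n = prepend (tops 0 j n) (chains K)

  length-reversedMatrices : ∀ K j n → + length (reversedMatrices K j n) ≡ A K j (+ n)
  length-reversedMatrices K j n = trans (length-prepend (tops 0 j n) (chains K))
    (total-tops j _ (f K) 0 n z≤n (λ v v∈ → length-chains K v (proj₁ (∈-tops⁻ 0 j n v z≤n v∈))))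

  -- Reversal of rows

  linked-∷ʳ : ∀ {X : Set} {R : X → X → Set} {n x y} (v : Vec X n) →
              Linked R (v ∷ʳ y) → R y x → Linked R ((v ∷ʳ y) ∷ʳ x)
  linked-∷ʳ []          [-]     r = r ∷ [-]
  linked-∷ʳ (a ∷ [])    (p ∷ l) r = p ∷ linked-∷ʳ [] l r
  linked-∷ʳ (a ∷ b ∷ v) (p ∷ l) r = p ∷ linked-∷ʳ (b ∷ v) l r

  linked-reverse : ∀ {X : Set} {R : X → X → Set} {n} {v : Vec X n} →
                   Linked R v → Linked (λ x y → R y x) (reverse v)
  linked-reverse [] = []
  linked-reverse [-] = [-]
  linked-reverse {R = R} {v = x ∷ y ∷ v} (p ∷ l) = subst (Linked _) (sym (Vec.reverse-∷ x (y ∷ v)))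
    (subst (λ w → Linked (λ x y → R y x) (w ∷ʳ x)) (sym (Vec.reverse-∷ y v))
      (linked-∷ʳ (reverse v) (subst (Linked _) (Vec.reverse-∷ y v) (linked-reverse l)) p))

  pointwise-∷ʳ : ∀ {X : Set} {R : X → X → Set} {n x y} {v w : Vec X n} →
                 Pointwise R v w → R x y → Pointwise R (v ∷ʳ x) (w ∷ʳ y)
  pointwise-∷ʳ []       r = r ∷ []
  pointwise-∷ʳ (p ∷ ps) r = p ∷ pointwise-∷ʳ ps r

  pointwise-reverse : ∀ {X : Set} {R : X → X → Set} {n} {v w : Vec X n} →
                      Pointwise R v w → Pointwise R (reverse v) (reverse w)
  pointwise-reverse [] = []
  pointwise-reverse {R = R} {v = x ∷ v} {w = y ∷ w} (p ∷ ps) =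
    subst (λ u → Pointwise R u (reverse (y ∷ w))) (sym (Vec.reverse-∷ x v))
      (subst (Pointwise R (reverse v ∷ʳ x)) (sym (Vec.reverse-∷ y w)) (pointwise-∷ʳ (pointwise-reverse ps) p))

  sum-∷ʳ : ∀ {n} (v : Vec ℕ n) x → Vec.sum (v ∷ʳ x) ≡ x ℕ.+ Vec.sum v
  sum-∷ʳ []      x = refl
  sum-∷ʳ (y ∷ v) x = trans (cong (y ℕ.+_) (sum-∷ʳ v x))
    (trans (sym (ℕ.+-assoc y x _)) (trans (cong (ℕ._+ Vec.sum v) (ℕ.+-comm y x)) (ℕ.+-assoc x y _)))

  sum-reverse : ∀ {n} (v : Vec ℕ n) → Vec.sum (reverse v) ≡ Vec.sum v
  sum-reverse []      = refl
  sum-reverse (x ∷ v) = trans (cong Vec.sum (Vec.reverse-∷ x v))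
    (trans (sum-∷ʳ (reverse v) x) (cong (x ℕ.+_) (sum-reverse v)))

  linked⇒increasing : ∀ {n x} {v : Vec ℕ n} → Linked ℕ._≤_ (x ∷ v) → Increasing x v
  linked⇒increasing [-]                 = tt
  linked⇒increasing {v = _ ∷ _} (p ∷ l) = p , linked⇒increasing l

  increasing⇒linked : ∀ {n x} (v : Vec ℕ n) → Increasing x v → Linked ℕ._≤_ (x ∷ v)
  increasing⇒linked []      _       = [-]
  increasing⇒linked (y ∷ v) (p , i) = p ∷ increasing⇒linked v i

  linked⇒increasing₀ : ∀ {n} {v : Vec ℕ n} → Linked ℕ._≤_ v → Increasing 0 v
  linked⇒increasing₀ {v = []}    _ = tt
  linked⇒increasing₀ {v = _ ∷ _} l = z≤n , linked⇒increasing l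

  increasing₀⇒linked : ∀ {n} (v : Vec ℕ n) → Increasing 0 v → Linked ℕ._≤_ v
  increasing₀⇒linked []      _       = []
  increasing₀⇒linked (x ∷ v) (_ , i) = increasing⇒linked v i

  Chain : ∀ {r K} → Vec ℕ r → Matrix K r → Set
  Chain v []      = ⊤
  Chain v (w ∷ M) = (Increasing 0 w × Pointwise ℕ._≤_ w v) × Chain w M

  ∈-chains⁺ : ∀ {r K} (v : Vec ℕ r) (M : Matrix K r) → Chain v M → M ∈ chains K v
  ∈-chains⁺ v []      _             = here refl
  ∈-chains⁺ v (w ∷ M) ((i , p) , c) = ∈-prepend⁺ {B = chains _} (∈-below⁺ i p) (∈-chains⁺ w M c)

  ∈-chains⁻ : ∀ {r K} (v : Vec ℕ r) (M : Matrix K r) → M ∈ chains K v → Chain v M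
  ∈-chains⁻ v []      _ = tt
  ∈-chains⁻ v (w ∷ M) p with w∈ , M∈ ← ∈-prepend⁻ (below 0 v) (chains _) p = ∈-below⁻ 0 w v w∈ , ∈-chains⁻ w M M∈

  reverseRows : ∀ {k r} → Matrix k r → Matrix k r
  reverseRows = Vec.map reverse

  reverseRows-involutive : ∀ {k r} (M : Matrix k r) → reverseRows (reverseRows M) ≡ M
  reverseRows-involutive []      = refl
  reverseRows-involutive (v ∷ M) = cong₂ _∷_ (Vec.reverse-involutive v) (reverseRows-involutive M)

  reverseRows-injective : ∀ {k r} {M N : Matrix k r} → reverseRows M ≡ reverseRows N → M ≡ N
  reverseRows-injective {M = M} {N} e =
    trans (sym (reverseRows-involutive M)) (trans (cong reverseRows e) (reverseRows-involutive N))

  decreasing⇒chain : ∀ {k r} (v : Vec ℕ r) (M : Matrix k r) → RowsDecreasing M → ColumnsDecreasing (v ∷ M) →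
                     Chain (reverse v) (reverseRows M)
  decreasing⇒chain v []      _        _       = tt
  decreasing⇒chain v (w ∷ M) (l ∷ ls) (p ∷ c) =
    (linked⇒increasing₀ (linked-reverse l) , pointwise-reverse (Pointwise.sym (λ q → q) p)) , decreasing⇒chain w M ls c

  chain⇒decreasing : ∀ {k r} (v : Vec ℕ r) (M : Matrix k r) → Chain v M →
                     RowsDecreasing (reverseRows M) × ColumnsDecreasing (reverse v ∷ reverseRows M)
  chain⇒decreasing v []      _             = [] , [-]
  chain⇒decreasing v (w ∷ M) ((i , p) , c) with ls , cs ← chain⇒decreasing w M c =
    linked-reverse (increasing₀⇒linked w i) ∷ ls , pointwise-reverse (Pointwise.sym (λ q → q) p) ∷ cs

  admissible⇒∈ : ∀ {K j n} (M : Matrix (suc K) (suc j)) → Admissible n M → reverseRows M ∈ reversedMatrices K j n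
  admissible⇒∈ {K} (v ∷ M) (l ∷ ls , c , s) = ∈-prepend⁺ {B = chains K}
    (∈-tops⁺ _ (reverse v) (linked⇒increasing₀ (linked-reverse l)) (trans (sum-reverse v) s))
    (∈-chains⁺ (reverse v) (reverseRows M) (decreasing⇒chain v M ls c))

  ∈⇒admissible : ∀ {K j n} (M : Matrix (suc K) (suc j)) → M ∈ reversedMatrices K j n → Admissible n (reverseRows M)
  ∈⇒admissible {K} {j} {n} (v ∷ M) p
    with v∈ , M∈ ← ∈-prepend⁻ (tops 0 j n) (chains K) p
    with i , s ← ∈-tops⁻ 0 j n v z≤n v∈ | ls , c ← chain⇒decreasing v M (∈-chains⁻ v M M∈) =
    linked-reverse (increasing₀⇒linked v i) ∷ ls , c , trans (sum-reverse v) s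

  -- Lists without repetitions that have the same members are permutations of each other. The list
  -- defining `α` is compared in this way with the one built along the nested sums, after its rows
  -- are reversed.
  α≡A : ∀ K j n → + α (suc K) (suc j) n ≡ A K j (+ n)
  α≡A K j n = trans (cong +_ (trans (↭-length (∼bag⇒↭ (unique∧set⇒bag
      (admissibles-unique (suc K) (suc j) n)
      (Unique.map⁺ reverseRows-injective
        (prepend-unique (tops-unique 0 j n) (chains-unique K)))
      (mk⇔ to from))))
    (List.length-map reverseRows (reversedMatrices K j n))))
    (length-reversedMatrices K j n)
    where
    to : ∀ {M} → M ∈ admissibles (suc K) (suc j) n → M ∈ map reverseRows (reversedMatrices K j n)
    to {M} M∈ = subst (_∈ map reverseRows (reversedMatrices K j n)) (reverseRows-involutive M)
      (∈-map⁺ reverseRows (admissible⇒∈ M (∈-admissibles⁻ M∈)))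
    from : ∀ {M} → M ∈ map reverseRows (reversedMatrices K j n) → M ∈ admissibles (suc K) (suc j) n
    from M∈ with N , N∈ , refl ← ∈-map⁻ reverseRows M∈ = ∈-admissibles⁺ (∈⇒admissible N N∈)

open Counting

open import Data.Nat.Base using (_≤_; _+_; _*_; _∸_; _/_)

theorem1 : ∀ (k r : ℕ) → 1 ≤ k → 1 ≤ r →
    ∃[ F ] (F ExpandsTo (λ n → + α k r n)) ×
    (F ≃ const (-1ℤ ℤ.^ (k * r)) · x⁻¹ ^ᵣ (r * (r ∸ 1 + 2 * k) / 2) · F ⟨1/x⟩)
theorem1 (suc K) (suc j) _ _ = functionalEquation K j (α≡A K j)
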